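{- Let $p$ be a prime, let $m\ge 0$ be an integer, and let $f:\mathbb{Z}_p\to\mathbb{Z}_p$ be an analytic function of level $m$. Then $f$ is an arithmetic differential operator of order $m$.
   Context: $\mathbb{Z}_p$ denotes the ring of $p$-adic integers with the $p$-adic norm $|\cdot|_p$, $|p|_p=p^{ -1}$. The Fermat quotient operator is $\delta:\mathbb{Z}_p\to\mathbb{Z}_p$, $\delta a=(a-a^p)/p$, and $\delta^i$ denotes its $i$-th iterate. A power series $F=\sum_{\alpha} a_\alpha x^\alpha\in\mathbb{Z}_p[[x_0,\dots,x_k]]$ is called restricted if $a_\alpha\to 0$ $p$-adically as $|\alpha|=\alpha_0+\dots+\alpha_k\to\infty$. A function $f:\mathbb{Z}_p\to\mathbb{Z}_p$ is an arithmetic differential operator of order $m$ if there is a restricted power series $F\in\mathbb{Z}_p[[x_0,\dots,x_m]]$ with $f(a)=F(a,\delta a,\dots,\delta^m a)$ for all $a\in\mathbb{Z}_p$. A function $f:\mathbb{Z}_p\to\mathbb{Z}_p$ is analytic of level $m$ if for every $a\in\mathbb{Z}_p$ there is a restricted power series $F_a\in\mathbb{Z}_p[[x]]$ (one variable) such that $f(a+p^m u)=F_a(u)$ for all $u\in\mathbb{Z}_p$. -}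

module Defs where

open import Algebra.Bundles using (CommutativeRing)
open import Algebra.Structures using (IsCommutativeRing)
open import Data.Empty using (⊥-elim)
open import Data.Fin.Base as Fin using (Fin; toℕ; fromℕ; inject₁)
open import Data.Fin.Properties using (toℕ<n; toℕ-fromℕ; toℕ-inject₁)
open import Data.Integer.Base as ℤ using (ℤ; +_; -[1+_]; 0ℤ; 1ℤ)
open import Data.Integer.Divisibility.Signed as ℤ∣ using (divides) renaming (_∣_ to _∣ℤ_)
open import Data.Integer.Tactic.RingSolver using (solve-∀)
open import Data.List.Base as List using (List)
open import Data.Nat.Base as ℕ using (ℕ; zero; suc; _≤_; _<_; s≤s; z≤n; _!)
open import Data.Nat.Combinatorics using (_C_; nCk≡n!/k![n-k]!; nCn≡1; k![n∸k]!∣n!)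
open import Data.Nat.Primality using (Prime; prime⇒nonZero; prime⇒nonTrivial; euclidsLemma)
open import Data.Product.Base using (Σ-syntax; ∃-syntax; _×_; _,_)
open import Data.Sum.Base using (inj₁; inj₂)
open import Data.Vec.Base as Vec using (Vec; []; _∷_)
open import Function.Base using (_∘_)
open import Function.Bundles using (Func)
open import Level using (0ℓ)
open import Relation.Binary.PropositionalEquality using (_≡_; refl; sym; trans; cong; cong₂; subst; subst₂)
open import Relation.Nullary using (¬_)

import Algebra.Definitions.RawSemiring
import Algebra.Properties.CommutativeSemiring.Binomial
import Algebra.Properties.Monoid.Sum
import Algebra.Properties.Semiring.Exp
import Data.Integer.Properties as ℤProp
import Data.Nat.Divisibility as ℕ∣
import Data.Nat.DivMod as ℕ/
import Data.Nat.Properties as ℕProp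

infix 4 _≡_[mod_]

record _≡_[mod_] (x y d : ℤ) : Set where
  constructor mk
  field diff : d ∣ℤ (x ℤ.- y)

open _≡_[mod_] public

module _ {d : ℤ} where

  mod-reflexive : ∀ {x y} → x ≡ y → x ≡ y [mod d ]
  mod-reflexive {x} refl = mk (divides 0ℤ (ℤProp.+-inverseʳ x))

  mod-sym : ∀ {x y} → x ≡ y [mod d ] → y ≡ x [mod d ]
  mod-sym {x} {y} (mk p) = mk (subst (d ∣ℤ_) (eq x y) (ℤ∣.∣m⇒∣-m p))
    where eq : ∀ x y → ℤ.- (x ℤ.- y) ≡ y ℤ.- x
          eq = solve-∀

  mod-trans : ∀ {x y z} → x ≡ y [mod d ] → y ≡ z [mod d ] → x ≡ z [mod d ]
  mod-trans {x} {y} {z} (mk p) (mk q) = mk (subst (d ∣ℤ_) (eq x y z) (ℤ∣.∣m∣n⇒∣m+n p q))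
    where eq : ∀ x y z → (x ℤ.- y) ℤ.+ (y ℤ.- z) ≡ x ℤ.- z
          eq = solve-∀

  mod-+ : ∀ {x x′ y y′} → x ≡ x′ [mod d ] → y ≡ y′ [mod d ] → x ℤ.+ y ≡ x′ ℤ.+ y′ [mod d ]
  mod-+ {x} {x′} {y} {y′} (mk p) (mk q) = mk (subst (d ∣ℤ_) (eq x x′ y y′) (ℤ∣.∣m∣n⇒∣m+n p q))
    where eq : ∀ x x′ y y′ → (x ℤ.- x′) ℤ.+ (y ℤ.- y′) ≡ (x ℤ.+ y) ℤ.- (x′ ℤ.+ y′)
          eq = solve-∀

  mod-neg : ∀ {x x′} → x ≡ x′ [mod d ] → ℤ.- x ≡ ℤ.- x′ [mod d ]
  mod-neg {x} {x′} (mk p) = mk (subst (d ∣ℤ_) (eq x x′) (ℤ∣.∣m⇒∣-m p))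
    where eq : ∀ x x′ → ℤ.- (x ℤ.- x′) ≡ (ℤ.- x) ℤ.- (ℤ.- x′)
          eq = solve-∀

  mod-* : ∀ {x x′ y y′} → x ≡ x′ [mod d ] → y ≡ y′ [mod d ] → x ℤ.* y ≡ x′ ℤ.* y′ [mod d ]
  mod-* {x} {x′} {y} {y′} (mk p) (mk q) =
    mk (subst (d ∣ℤ_) (eq x x′ y y′) (ℤ∣.∣m∣n⇒∣m+n (ℤ∣.∣m⇒∣m*n y p) (ℤ∣.∣n⇒∣m*n x′ q)))
    where eq : ∀ x x′ y y′ → (x ℤ.- x′) ℤ.* y ℤ.+ x′ ℤ.* (y ℤ.- y′) ≡ x ℤ.* y ℤ.- x′ ℤ.* y′
          eq = solve-∀

  mod-^ : ∀ {x x′} k → x ≡ x′ [mod d ] → x ℤ.^ k ≡ x′ ℤ.^ k [mod d ]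
  mod-^ zero    p = mod-reflexive refl
  mod-^ (suc k) p = mod-* p (mod-^ k p)

∣⇒mod-0 : ∀ {d x} → d ∣ℤ x → x ≡ 0ℤ [mod d ]
∣⇒mod-0 {d} {x} d∣x = mk (subst (d ∣ℤ_) (sym (ℤProp.+-identityʳ x)) d∣x)

module _ {p : ℕ} (p-prime : Prime p) where

  prime∤! : ∀ k → k < p → ¬ (p ℕ∣.∣ k !)
  prime∤! zero    _   p∣1 = ℕProp.<⇒≱ (ℕ.nonTrivial⇒n>1 p ⦃ prime⇒nonTrivial p-prime ⦄) (ℕ∣.∣⇒≤ p∣1)
  prime∤! (suc k) k<p p∣! with euclidsLemma (suc k) (k !) p-prime p∣!
  ... | inj₁ p∣1+k = ℕProp.<⇒≱ k<p (ℕ∣.∣⇒≤ p∣1+k)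
  ... | inj₂ p∣k!  = prime∤! k (ℕProp.<-trans (ℕProp.n<1+n k) k<p) p∣k!

  prime∣C : ∀ k → 0 < k → k < p → p ℕ∣.∣ (p C k)
  prime∣C k 0<k k<p with euclidsLemma (p C k) (k ! ℕ.* (p ℕ.∸ k) !) p-prime p∣prod
    where
    instance
      _ = prime⇒nonZero p-prime
      _ = k ℕProp.!* (p ℕ.∸ k) !≢0
    k≤p = ℕProp.<⇒≤ k<p
    n∣n! : ∀ n → .⦃ ℕ.NonZero n ⦄ → n ℕ∣.∣ n !
    n∣n! (suc q) = ℕ∣.m∣m*n (q !)
    p∣prod : p ℕ∣.∣ (p C k) ℕ.* (k ! ℕ.* (p ℕ.∸ k) !)
    p∣prod = subst (p ℕ∣.∣_)
      (sym (trans (cong (ℕ._* (k ! ℕ.* (p ℕ.∸ k) !)) (nCk≡n!/k![n-k]! k≤p))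
                  (ℕ/.m/n*n≡m (k![n∸k]!∣n! k≤p))))
      (n∣n! p)
  ... | inj₁ p∣C = p∣C
  ... | inj₂ p∣k!l! with euclidsLemma (k !) ((p ℕ.∸ k) !) p-prime p∣k!l!
  ...   | inj₁ p∣k! = ⊥-elim (prime∤! k k<p p∣k!)
  ...   | inj₂ p∣l! = ⊥-elim (prime∤! (p ℕ.∸ k) (ℕProp.∸-monoʳ-< 0<k (ℕProp.<⇒≤ k<p)) p∣l!)

private
  module ℤ-Binomial = Algebra.Properties.CommutativeSemiring.Binomial ℤProp.+-*-commutativeSemiring
  module ℤ-Raw = Algebra.Definitions.RawSemiring ℤ.+-*-rawSemiring
  module ℤ-Sum = Algebra.Properties.Monoid.Sum ℤProp.+-0-monoid

  ^-raw : ∀ x n → x ℤ-Raw.^ n ≡ x ℤ.^ n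
  ^-raw x zero    = refl
  ^-raw x (suc n) = cong (x ℤ.*_) (^-raw x n)

  ×-raw : ∀ n x → n ℤ-Raw.× x ≡ + n ℤ.* x
  ×-raw zero    x = sym (ℤProp.*-zeroˡ x)
  ×-raw (suc n) x = trans (cong (λ w → x ℤ.+ w) (×-raw n x)) (sym (ℤProp.suc-* (+ n) x))

  sum-mod-0 : ∀ {d n} (t : Fin n → ℤ) → (∀ i → t i ≡ 0ℤ [mod d ]) → ℤ-Raw.sum t ≡ 0ℤ [mod d ]
  sum-mod-0 {n = zero}  t t≡0 = mod-reflexive refl
  sum-mod-0 {n = suc n} t t≡0 = mod-+ (t≡0 Fin.zero) (sum-mod-0 (t ∘ Fin.suc) (t≡0 ∘ Fin.suc))

private
  ×-mod-0 : ∀ {d} n x → d ℕ∣.∣ n → n ℤ-Raw.× x ≡ 0ℤ [mod + d ]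
  ×-mod-0 {d} n x d∣n =
    ∣⇒mod-0 (subst (+ d ∣ℤ_) (sym (×-raw n x)) (ℤ∣.∣m⇒∣m*n {m = + n} x (ℤ∣.∣ᵤ⇒∣ d∣n)))

[1+z]^p : ∀ {p} → Prime p → ∀ z → (1ℤ ℤ.+ z) ℤ.^ p ≡ 1ℤ ℤ.+ z ℤ.^ p [mod + p ]
[1+z]^p {zero}        p-prime z = ⊥-elim (ℕ.≢-nonZero⁻¹ 0 ⦃ prime⇒nonZero p-prime ⦄ refl)
[1+z]^p {p = p@(suc q)} p-prime z = subst₂ (_≡_[mod + p ]) (sym expand) refl
  (mod-+ (mod-reflexive first) 
    (mod-trans {y = 0ℤ ℤ.+ z ℤ.^ p} (mod-+ middle (mod-reflexive last)) (mod-reflexive (ℤProp.+-identityˡ (z ℤ.^ p)))))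
  where
  term : Fin (suc p) → ℤ
  term = ℤ-Binomial.binomialTerm z 1ℤ p
  one^ : ∀ n → 1ℤ ℤ-Raw.^ n ≡ 1ℤ
  one^ zero    = refl
  one^ (suc n) = trans (ℤProp.*-identityˡ _) (one^ n)
  expand : (1ℤ ℤ.+ z) ℤ.^ p ≡ term Fin.zero ℤ.+ (ℤ-Raw.sum (λ i → term (Fin.suc (inject₁ i))) ℤ.+ term (fromℕ p))
  expand = trans (cong (ℤ._^ p) (ℤProp.+-comm 1ℤ z))
          (trans (sym (^-raw (z ℤ.+ 1ℤ) p))
          (trans (ℤ-Binomial.theorem p z 1ℤ)
                 (cong (λ w → term Fin.zero ℤ.+ w) (ℤ-Sum.sum-init-last (term ∘ Fin.suc)))))
  first : term Fin.zero ≡ 1ℤ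
  first = trans (×-raw 1 _) (trans (ℤProp.*-identityˡ _) (trans (ℤProp.*-identityˡ _) (one^ p)))
  last : term (fromℕ p) ≡ z ℤ.^ p
  last rewrite toℕ-fromℕ q | nCn≡1 p | ℕProp.n∸n≡0 q =
    trans (ℤProp.+-identityʳ _) (trans (ℤProp.*-identityʳ _) (^-raw z p))
  middle : ℤ-Raw.sum (λ i → term (Fin.suc (inject₁ i))) ≡ 0ℤ [mod + p ]
  middle = sum-mod-0 _ λ i → ×-mod-0 (p C suc (toℕ (inject₁ i))) _
    (prime∣C p-prime (suc (toℕ (inject₁ i))) (s≤s z≤n)
      (s≤s (subst (_< q) (sym (toℕ-inject₁ i)) (toℕ<n i))))

fermat : ∀ {p} → Prime p → ∀ z → z ≡ z ℤ.^ p [mod + p ]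
fermat {p} p-prime = go
  where
  cancel : ∀ z → -[1+ 0 ] ℤ.+ (1ℤ ℤ.+ z) ≡ z
  cancel = solve-∀
  down : ∀ z → 1ℤ ℤ.+ z ≡ (1ℤ ℤ.+ z) ℤ.^ p [mod + p ] → z ≡ z ℤ.^ p [mod + p ]
  down z h = subst₂ (_≡_[mod + p ]) (cancel z) (cancel (z ℤ.^ p))
    (mod-+ {x = -[1+ 0 ]} (mod-reflexive refl) (mod-trans h ([1+z]^p p-prime z)))
  0^ : ∀ n → .⦃ ℕ.NonZero n ⦄ → 0ℤ ≡ 0ℤ ℤ.^ n
  0^ (suc n) = sym (ℤProp.*-zeroˡ (0ℤ ℤ.^ n))
  go : ∀ z → z ≡ z ℤ.^ p [mod + p ]
  go (+ zero)       = mod-reflexive (0^ p ⦃ prime⇒nonZero p-prime ⦄)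
  go (+ suc n)      = mod-trans (mod-+ {x = 1ℤ} (mod-reflexive refl) (go (+ n))) (mod-sym ([1+z]^p p-prime (+ n)))
  go -[1+ zero ]    = down -[1+ 0 ] (go (+ 0))
  go -[1+ suc n ]   = down -[1+ suc n ] (go -[1+ n ])

module Padic (p : ℕ) (p-prime : Prime p) where

  private instance
    p-nonZero : ℕ.NonZero p
    p-nonZero = prime⇒nonZero p-prime

  p^ : ℕ → ℤ
  p^ n = + (p ℕ.^ n)

  p^-suc : ∀ n → p^ (suc n) ≡ + p ℤ.* p^ n
  p^-suc n = ℤProp.pos-* p (p ℕ.^ n)

  -- ℤ_p as the inverse limit of the rings ℤ/pⁿ; rep x n is an integer
  -- representing the image of x in ℤ/pⁿ.

  record ℤ-p : Set where
    constructor mkℤ-p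
    field
      rep      : ℕ → ℤ
      coherent : ∀ n → rep (suc n) ≡ rep n [mod p^ n ]

  open ℤ-p public

  -- x ≡ y [p^ n ] says that x and y have the same image in ℤ/pⁿ,
  -- i.e. |x - y|_p ≤ p⁻ⁿ.

  infix 4 _≡_[p^_] _≈_

  _≡_[p^_] : ℤ-p → ℤ-p → ℕ → Set
  x ≡ y [p^ n ] = rep x n ≡ rep y n [mod p^ n ]

  _≈_ : ℤ-p → ℤ-p → Set
  x ≈ y = ∀ n → x ≡ y [p^ n ]

  fromℤ : ℤ → ℤ-p
  fromℤ z = mkℤ-p (λ _ → z) (λ _ → mod-reflexive refl)

  infixl 6 _+_ _-_
  infixl 7 _*_
  infix  8 -_

  _+_ _*_ : ℤ-p → ℤ-p → ℤ-p
  x + y = mkℤ-p (λ n → rep x n ℤ.+ rep y n) (λ n → mod-+ (coherent x n) (coherent y n))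
  x * y = mkℤ-p (λ n → rep x n ℤ.* rep y n) (λ n → mod-* (coherent x n) (coherent y n))

  -_ : ℤ-p → ℤ-p
  - x = mkℤ-p (λ n → ℤ.- rep x n) (λ n → mod-neg (coherent x n))

  _-_ : ℤ-p → ℤ-p → ℤ-p
  x - y = x + (- y)

  isCommutativeRing : IsCommutativeRing _≈_ _+_ _*_ -_ (fromℤ 0ℤ) (fromℤ 1ℤ)
  isCommutativeRing = record
    { isRing = record
      { +-isAbelianGroup = record
        { isGroup = record
          { isMonoid = record
            { isSemigroup = record
              { isMagma = record
                { isEquivalence = record
                  { refl  = λ n → mod-reflexive refl
                  ; sym   = λ e n → mod-sym (e n)
                  ; trans = λ e f n → mod-trans (e n) (f n)
                  }
                ; ∙-cong = λ e f n → mod-+ (e n) (f n)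
                }
              ; assoc = λ x y z n → mod-reflexive (ℤProp.+-assoc (rep x n) (rep y n) (rep z n))
              }
            ; identity = (λ x n → mod-reflexive (ℤProp.+-identityˡ (rep x n)))
                       , (λ x n → mod-reflexive (ℤProp.+-identityʳ (rep x n)))
            }
          ; inverse = (λ x n → mod-reflexive (ℤProp.+-inverseˡ (rep x n)))
                    , (λ x n → mod-reflexive (ℤProp.+-inverseʳ (rep x n)))
          ; ⁻¹-cong = λ e n → mod-neg (e n)
          }
        ; comm = λ x y n → mod-reflexive (ℤProp.+-comm (rep x n) (rep y n))
        }
      ; *-cong = λ e f n → mod-* (e n) (f n)
      ; *-assoc = λ x y z n → mod-reflexive (ℤProp.*-assoc (rep x n) (rep y n) (rep z n))
      ; *-identity = (λ x n → mod-reflexive (ℤProp.*-identityˡ (rep x n)))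
                   , (λ x n → mod-reflexive (ℤProp.*-identityʳ (rep x n)))
      ; distrib = (λ x y z n → mod-reflexive (ℤProp.*-distribˡ-+ (rep x n) (rep y n) (rep z n)))
                , (λ x y z n → mod-reflexive (ℤProp.*-distribʳ-+ (rep x n) (rep y n) (rep z n)))
      }
    ; *-comm = λ x y n → mod-reflexive (ℤProp.*-comm (rep x n) (rep y n))
    }

  commutativeRing : CommutativeRing 0ℓ 0ℓ
  commutativeRing = record { isCommutativeRing = isCommutativeRing }

  open CommutativeRing commutativeRing public using (setoid; semiring; 0#; 1#)
  open Algebra.Properties.Semiring.Exp semiring public using (_^_)

  rep-^ : ∀ x k n → rep (x ^ k) n ≡ rep x n ℤ.^ k
  rep-^ x zero    n = refl
  rep-^ x (suc k) n = cong (rep x n ℤ.*_) (rep-^ x k n)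

  -- δ a = (a - aᵖ)/p. The exact quotient of an integer known mod pⁿ⁺¹ by p
  -- is known mod pⁿ, hence the index shift.

  fermatQuotient : ℤ → ℤ
  fermatQuotient z = _∣ℤ_.quotient (diff (fermat p-prime z))

  fermatQuotient-eq : ∀ z → fermatQuotient z ℤ.* + p ≡ z ℤ.- z ℤ.^ p
  fermatQuotient-eq z = sym (_∣ℤ_.equality (diff (fermat p-prime z)))

  fermatQuotient-mod : ∀ {x y} n → x ≡ y [mod p^ (suc n) ] → fermatQuotient x ≡ fermatQuotient y [mod p^ n ]
  fermatQuotient-mod {x} {y} n x≡y = mk (ℤ∣.*-cancelʳ-∣ (+ p)
    (subst₂ _∣ℤ_ (trans (p^-suc n) (ℤProp.*-comm (+ p) (p^ n))) eq
      (diff (mod-+ x≡y (mod-neg (mod-^ p x≡y))))))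
    where
    distrib : ∀ a b c → a ℤ.* c ℤ.- b ℤ.* c ≡ (a ℤ.- b) ℤ.* c
    distrib = solve-∀
    eq : (x ℤ.- x ℤ.^ p) ℤ.- (y ℤ.- y ℤ.^ p) ≡ (fermatQuotient x ℤ.- fermatQuotient y) ℤ.* + p
    eq = trans (cong₂ ℤ._-_ (sym (fermatQuotient-eq x)) (sym (fermatQuotient-eq y)))
               (distrib (fermatQuotient x) (fermatQuotient y) (+ p))

  δ : ℤ-p → ℤ-p
  δ a = mkℤ-p (λ n → fermatQuotient (rep a (suc n)))
              (λ n → fermatQuotient-mod n (coherent a (suc n)))

  δ-cong : ∀ {a b} → a ≈ b → δ a ≈ δ b
  δ-cong a≈b n = fermatQuotient-mod n (a≈b (suc n))

  δ-spec : ∀ a → fromℤ (+ p) * δ a ≈ a - a ^ p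
  δ-spec a n = mod-trans
    (mod-reflexive (trans (ℤProp.*-comm (+ p) _) (fermatQuotient-eq (rep a (suc n)))))
    (mod-+ (coherent a n)
           (mod-neg (mod-trans (mod-^ p (coherent a n)) (mod-reflexive (sym (rep-^ a p n))))))

  -- Formal power series in k variables: α ↦ coefficient of x^α.

  PowerSeries : ℕ → Set
  PowerSeries k = Vec ℕ k → ℤ-p

  -- |α| = Vec.sum α.

  Restricted : ∀ {k} → PowerSeries k → Set
  Restricted F = ∀ n → ∃[ N ] (∀ α → N ≤ Vec.sum α → F α ≡ 0# [p^ n ])

  monomial : ∀ {k} → Vec ℤ-p k → Vec ℕ k → ℤ-p
  monomial []       []       = 1#
  monomial (x ∷ xs) (i ∷ α)  = x ^ i * monomial xs α

  -- The exponents α with |α| = d, each listed once.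

  exponents : ∀ k → ℕ → List (Vec ℕ k)
  exponents zero    zero    = [] List.∷ List.[]
  exponents zero    (suc d) = List.[]
  exponents (suc k) d       =
    List.concatMap (λ i → List.map (i ∷_) (exponents k (d ℕ.∸ i))) (List.upTo (suc d))

  sumOver : ∀ {A : Set} → List A → (A → ℤ-p) → ℤ-p
  sumOver as t = List.foldr (λ a s → t a + s) 0# as

  -- Σ_{|α| < N} F_α x^α

  partialSum : ∀ {k} → PowerSeries k → Vec ℤ-p k → ℕ → ℤ-p
  partialSum {k} F x N =
    sumOver (List.upTo N) λ d → sumOver (exponents k d) λ α → F α * monomial x α

  infix 4 _⟶_ _⟨_⟩≈_

  _⟶_ : (ℕ → ℤ-p) → ℤ-p → Set
  s ⟶ y = ∀ n → ∃[ N ] (∀ M → N ≤ M → s M ≡ y [p^ n ])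

  -- F(x) = y, the value of a series being the limit of its partial sums.

  _⟨_⟩≈_ : ∀ {k} → PowerSeries k → Vec ℤ-p k → ℤ-p → Set
  F ⟨ x ⟩≈ y = partialSum F x ⟶ y

  -- A function ℤ_p → ℤ_p is a map of setoids, that is, one respecting _≈_.

  module _ (m : ℕ) (f : Func setoid setoid) where

    open Func f using (to)

    IsAnalyticOfLevel : Set
    IsAnalyticOfLevel =
      ∀ a → Σ[ F ∈ PowerSeries 1 ]
        Restricted F × (∀ u → F ⟨ u ∷ [] ⟩≈ to (a + fromℤ (+ p) ^ m * u))

    -- Vec.iterate δ a (suc m) is the vector (a, δ a, …, δᵐ a).

    IsArithmeticDifferentialOperatorOfOrder : Set
    IsArithmeticDifferentialOperatorOfOrder =
      Σ[ F ∈ PowerSeries (suc m) ]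
        Restricted F × (∀ a → F ⟨ Vec.iterate δ a (suc m) ⟩≈ to a)

{-# OPTIONS --safe #-}
module Submission where

-- Write π for p. From (c + πt)ᵖ = cᵖ + π²t(…) one gets δ(c + πt) = δc + t - πt(…), so δ maps the ball
-- c + πᵐ⁺¹ℤ_p to δc + πᵐℤ_p, modulo π identically on the scaled coordinate u, and residue classes modulo
-- πᵐ⁺¹ are separated by a modulo π together with δa modulo πᵐ. Inductively, the product of the
-- indicators 1 - (xᵢ - δⁱc)ᵖ⁻¹, i < m, with q(x_m - δᵐc) is a polynomial in a, …, δᵐa which modulo π
-- is q(u) at a = c + πᵐu and 0 on every other ball of radius πᵐ. Summing over the finitely many balls,
-- every family of polynomials on them is congruent modulo π to one polynomial P in a, …, δᵐa, and the
-- error is again π times a family of polynomials. A restricted series is a sum Σ πⁿTₙ of polynomials,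
-- so iterating gives f = Σ πⁿPₙ(a, …, δᵐa), whose coefficients form a restricted series.

open import Defs
open import Algebra.Bundles using (CommutativeRing)
open import Algebra.Solver.Ring.AlmostCommutativeRing using (fromCommutativeRing; _-Raw-AlmostCommutative⟶_)
open import Data.Fin.Base as Fin using (Fin)
open import Data.Integer.Base as ℤ using (ℤ; +_; 0ℤ; 1ℤ)
open import Data.Integer.Divisibility.Signed as ℤ∣ using (divides) renaming (_∣_ to _∣ℤ_)
open import Data.Integer.Tactic.RingSolver using (solve-∀)
open import Data.List.Base as List using (List)
open import Data.Maybe.Base using (Maybe; just; nothing)
open import Data.Nat using (ℕ)
open import Data.Nat.Base as ℕ using (zero; suc; _≤_; _<_; z≤n; s≤s; pred)
open import Data.Nat.Primality using (Prime; prime⇒nonZero; prime⇒nonTrivial; euclidsLemma)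
open import Data.Product.Base using (Σ-syntax; ∃-syntax; _×_; _,_; proj₁; proj₂; map₂)
open import Data.Sum.Base using (_⊎_; inj₁; inj₂)
open import Data.Vec.Base as Vec using (Vec; []; _∷_)
open import Data.Vec.Relation.Binary.Pointwise.Inductive as Pointwise using (Pointwise; []; _∷_)
open import Function.Base using (id; _∘_)
open import Function.Bundles using (Func)
open import Level using (0ℓ)
open import Relation.Binary.PropositionalEquality as ≡ using (_≡_)
open import Relation.Nullary using (¬_; yes; no; contradiction)

import Algebra.Properties.CommutativeSemigroup
import Algebra.Properties.Ring
import Algebra.Properties.Semiring.Exp
import Algebra.Solver.Ring
import Data.Integer.DivMod as ℤ/
import Data.Integer.Properties as ℤProp
import Data.Nat.Divisibility as ℕ∣
import Data.Nat.Properties as ℕProp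
import Relation.Binary.Reasoning.Setoid

-- Finite sums and Kronecker deltas over a commutative ring.

module FiniteSums (R : CommutativeRing 0ℓ 0ℓ) where

  open CommutativeRing R
  open Algebra.Properties.CommutativeSemigroup +-commutativeSemigroup using (interchange)
  open Relation.Binary.Reasoning.Setoid setoid

  -- This repeats the sum of `Padic` over an arbitrary ring: the algebra is carried out abstractly,
  -- and `sumOver≡` returns to the p-adic integers at the end.
  sumOver : ∀ {A : Set} → List A → (A → Carrier) → Carrier
  sumOver as t = List.foldr (λ a s → t a + s) 0# as

  sumOver-cong : ∀ {A : Set} (as : List A) {t t′ : A → Carrier} → (∀ a → t a ≈ t′ a) → sumOver as t ≈ sumOver as t′
  sumOver-cong List.[]       t≈t′ = refl
  sumOver-cong (a List.∷ as) t≈t′ = +-cong (t≈t′ a) (sumOver-cong as t≈t′)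

  sumOver-0 : ∀ {A : Set} (as : List A) {t : A → Carrier} → (∀ a → t a ≈ 0#) → sumOver as t ≈ 0#
  sumOver-0 List.[]       t≈0 = refl
  sumOver-0 (a List.∷ as) t≈0 = trans (+-cong (t≈0 a) (sumOver-0 as t≈0)) (+-identityˡ 0#)

  sumOver-+ : ∀ {A : Set} (as : List A) (t t′ : A → Carrier) →
              sumOver as (λ a → t a + t′ a) ≈ sumOver as t + sumOver as t′
  sumOver-+ List.[]       t t′ = sym (+-identityˡ 0#)
  sumOver-+ (a List.∷ as) t t′ = trans (+-congˡ (sumOver-+ as t t′)) (interchange _ _ _ _)

  sumOver-*ˡ : ∀ {A : Set} (as : List A) c (t : A → Carrier) →
               sumOver as (λ a → c * t a) ≈ c * sumOver as t
  sumOver-*ˡ List.[]       c t = sym (zeroʳ c)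
  sumOver-*ˡ (a List.∷ as) c t = trans (+-congˡ (sumOver-*ˡ as c t)) (sym (distribˡ c _ _))

  sumOver-++ : ∀ {A : Set} (as bs : List A) (t : A → Carrier) →
               sumOver (as List.++ bs) t ≈ sumOver as t + sumOver bs t
  sumOver-++ List.[]       bs t = sym (+-identityˡ _)
  sumOver-++ (a List.∷ as) bs t = trans (+-congˡ (sumOver-++ as bs t)) (sym (+-assoc _ _ _))

  sumOver-map : ∀ {A B : Set} (f : A → B) as (t : B → Carrier) → sumOver (List.map f as) t ≡ sumOver as (t ∘ f)
  sumOver-map f List.[]       t = ≡.refl
  sumOver-map f (a List.∷ as) t = ≡.cong (λ s → t (f a) + s) (sumOver-map f as t)

  sumOver-concatMap : ∀ {A B : Set} (f : A → List B) as (t : B → Carrier) →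
                      sumOver (List.concatMap f as) t ≈ sumOver as (λ a → sumOver (f a) t)
  sumOver-concatMap f List.[]       t = refl
  sumOver-concatMap f (a List.∷ as) t = trans (sumOver-++ (f a) _ t) (+-congˡ (sumOver-concatMap f as t))

  sumTo : ℕ → (ℕ → Carrier) → Carrier
  sumTo zero    g = 0#
  sumTo (suc n) g = g 0 + sumTo n (g ∘ suc)

  sumTo-cong : ∀ n {g g′ : ℕ → Carrier} → (∀ i → i < n → g i ≈ g′ i) → sumTo n g ≈ sumTo n g′
  sumTo-cong zero    g≈g′ = refl
  sumTo-cong (suc n) g≈g′ = +-cong (g≈g′ 0 (s≤s z≤n)) (sumTo-cong n λ i i<n → g≈g′ (suc i) (s≤s i<n))

  sumTo-0 : ∀ n {g : ℕ → Carrier} → (∀ i → i < n → g i ≈ 0#) → sumTo n g ≈ 0#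
  sumTo-0 zero    g≈0 = refl
  sumTo-0 (suc n) g≈0 =
    trans (+-cong (g≈0 0 (s≤s z≤n)) (sumTo-0 n λ i i<n → g≈0 (suc i) (s≤s i<n))) (+-identityˡ 0#)

  sumTo-*ˡ : ∀ n c (g : ℕ → Carrier) → sumTo n (λ i → c * g i) ≈ c * sumTo n g
  sumTo-*ˡ zero    c g = sym (zeroʳ c)
  sumTo-*ˡ (suc n) c g = trans (+-congˡ (sumTo-*ˡ n c (g ∘ suc))) (sym (distribˡ c _ _))

  sumTo-split : ∀ m n (g : ℕ → Carrier) → sumTo (m ℕ.+ n) g ≈ sumTo m g + sumTo n (λ i → g (m ℕ.+ i))
  sumTo-split zero    n g = sym (+-identityˡ _)
  sumTo-split (suc m) n g = trans (+-congˡ (sumTo-split m n (g ∘ suc))) (sym (+-assoc _ _ _))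

  sumOver-upTo : ∀ n (t : ℕ → Carrier) → sumOver (List.upTo n) t ≈ sumTo n t
  sumOver-upTo n t = go n id
    where
    go : ∀ n f → sumOver (List.applyUpTo f n) t ≈ sumTo n (t ∘ f)
    go zero    f = refl
    go (suc n) f = +-congˡ (go n (f ∘ suc))

  kronecker : ℕ → ℕ → Carrier
  kronecker zero    zero    = 1#
  kronecker zero    (suc j) = 0#
  kronecker (suc i) zero    = 0#
  kronecker (suc i) (suc j) = kronecker i j

  kronecker-≢ : ∀ i j → ¬ i ≡ j → kronecker i j ≡ 0#
  kronecker-≢ zero    zero    i≢j = contradiction ≡.refl i≢j
  kronecker-≢ zero    (suc j) i≢j = ≡.refl
  kronecker-≢ (suc i) zero    i≢j = ≡.refl
  kronecker-≢ (suc i) (suc j) i≢j = kronecker-≢ i j (i≢j ∘ ≡.cong suc)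

  -- `exponents` leaves degree `d ∸ i` to the remaining variables; `i ≤ d` rules out a truncated
  -- subtraction.
  kronecker-∸ : ∀ a {i d} → i ≤ d → kronecker a (d ℕ.∸ i) ≡ kronecker (i ℕ.+ a) d
  kronecker-∸ a {zero}          i≤d       = ≡.refl
  kronecker-∸ a {suc i} {suc d} (s≤s i≤d) = kronecker-∸ a i≤d

  kronecker-sym : ∀ i j → kronecker i j ≡ kronecker j i
  kronecker-sym zero    zero    = ≡.refl
  kronecker-sym zero    (suc j) = ≡.refl
  kronecker-sym (suc i) zero    = ≡.refl
  kronecker-sym (suc i) (suc j) = kronecker-sym i j

  sumTo-kronecker : ∀ n {i} (g : ℕ → Carrier) → i < n → sumTo n (λ j → kronecker i j * g j) ≈ g i
  sumTo-kronecker (suc n) {zero} g i<n =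
    trans (+-cong (*-identityˡ _) (sumTo-0 n λ j _ → zeroˡ _)) (+-identityʳ _)
  sumTo-kronecker (suc n) {suc i} g (s≤s i<n) =
    trans (+-cong (zeroˡ _) (sumTo-kronecker n (g ∘ suc) i<n)) (+-identityˡ _)

-- Monomials, exponents and partial sums of formal series.

module Polynomials (R : CommutativeRing 0ℓ 0ℓ) (p : ℕ) (p-prime : Prime p) where

  open CommutativeRing R
  open FiniteSums R
  open Algebra.Properties.Semiring.Exp semiring
  open Algebra.Properties.CommutativeSemigroup *-commutativeSemigroup using (interchange)
  open Padic p p-prime using (exponents)
  open Relation.Binary.Reasoning.Setoid setoid

  monomial : ∀ {k} → Vec Carrier k → Vec ℕ k → Carrier
  monomial []       []      = 1#
  monomial (x ∷ xs) (i ∷ α) = x ^ i * monomial xs α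

  partialSum : ∀ {k} → (Vec ℕ k → Carrier) → Vec Carrier k → ℕ → Carrier
  partialSum {k} F x N =
    sumOver (List.upTo N) λ d → sumOver (exponents k d) λ α → F α * monomial x α

  sumOver-exponents : ∀ k d (t : Vec ℕ (suc k) → Carrier) →
    sumOver (exponents (suc k) d) t ≈ sumTo (suc d) (λ i → sumOver (exponents k (d ℕ.∸ i)) (λ α → t (i ∷ α)))
  sumOver-exponents k d t = begin
    sumOver (exponents (suc k) d) t
      ≈⟨ sumOver-concatMap (λ i → List.map (i ∷_) (exponents k (d ℕ.∸ i))) (List.upTo (suc d)) t ⟩
    sumOver (List.upTo (suc d)) (λ i → sumOver (List.map (i ∷_) (exponents k (d ℕ.∸ i))) t)
      ≈⟨ sumOver-upTo (suc d) _ ⟩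
    sumTo (suc d) (λ i → sumOver (List.map (i ∷_) (exponents k (d ℕ.∸ i))) t)
      ≈⟨ sumTo-cong (suc d) (λ i _ → reflexive (sumOver-map (i ∷_) (exponents k (d ℕ.∸ i)) t)) ⟩
    sumTo (suc d) (λ i → sumOver (exponents k (d ℕ.∸ i)) (λ α → t (i ∷ α))) ∎

  sumOver-exponents₀ : ∀ d (t : Vec ℕ 0 → Carrier) → sumOver (exponents 0 d) t ≈ kronecker 0 d * t []
  sumOver-exponents₀ zero    t = trans (+-identityʳ _) (sym (*-identityˡ _))
  sumOver-exponents₀ (suc d) t = sym (zeroˡ _)

  sumOver-exponents₁ : ∀ d (t : Vec ℕ 1 → Carrier) → sumOver (exponents 1 d) t ≈ t (d ∷ [])
  sumOver-exponents₁ d t = begin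
    sumOver (exponents 1 d) t
      ≈⟨ sumOver-exponents 0 d t ⟩
    sumTo (suc d) (λ i → sumOver (exponents 0 (d ℕ.∸ i)) (λ α → t (i ∷ α)))
      ≈⟨ sumTo-cong (suc d) (λ i i<1+d → trans (sumOver-exponents₀ (d ℕ.∸ i) (λ α → t (i ∷ α))) (*-congʳ (reflexive (flip i (ℕProp.≤-pred i<1+d))))) ⟩
    sumTo (suc d) (λ i → kronecker d i * t (i ∷ []))
      ≈⟨ sumTo-kronecker (suc d) (λ i → t (i ∷ [])) (ℕProp.n<1+n d) ⟩
    t (d ∷ []) ∎
    where
    flip : ∀ i → i ≤ d → kronecker 0 (d ℕ.∸ i) ≡ kronecker d i
    flip i i≤d = ≡.trans (kronecker-∸ 0 i≤d)
      (≡.trans (≡.cong (λ j → kronecker j d) (ℕProp.+-identityʳ i)) (kronecker-sym i d))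

  -- As a coefficient function, `kroneckerᵛ α` is the series whose only term is the monomial with
  -- exponent `α`.
  kroneckerᵛ : ∀ {k} → Vec ℕ k → Vec ℕ k → Carrier
  kroneckerᵛ []      []      = 1#
  kroneckerᵛ (i ∷ α) (j ∷ β) = kronecker i j * kroneckerᵛ α β

  kroneckerᵛ-> : ∀ {k} (α β : Vec ℕ k) → Vec.sum α < Vec.sum β → kroneckerᵛ α β ≈ 0#
  kroneckerᵛ-> (i ∷ α) (j ∷ β) α<β with i ℕProp.≟ j
  ... | yes ≡.refl = trans (*-congˡ (kroneckerᵛ-> α β (ℕProp.+-cancelˡ-< i _ _ α<β))) (zeroʳ _)
  ... | no  i≢j    = trans (*-congʳ (reflexive (kronecker-≢ i j i≢j))) (zeroˡ _)

  -- This holds because `exponents k d` lists every exponent of degree `d` exactly once. The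
  -- induction splits off the first entry and leaves degree `d ∸ j` to the rest.
  sumOver-kroneckerᵛ : ∀ {k} (α : Vec ℕ k) d (t : Vec ℕ k → Carrier) →
    sumOver (exponents k d) (λ β → kroneckerᵛ α β * t β) ≈ kronecker (Vec.sum α) d * t α
  sumOver-kroneckerᵛ [] d t = trans (sumOver-exponents₀ d _) (*-congˡ (*-identityˡ _))
  sumOver-kroneckerᵛ {suc k} (i ∷ α) d t = begin
    sumOver (exponents (suc k) d) (λ β → kroneckerᵛ (i ∷ α) β * t β)
      ≈⟨ sumOver-exponents k d _ ⟩
    sumTo (suc d) (λ j → sumOver (exponents k (d ℕ.∸ j)) (λ β → kronecker i j * kroneckerᵛ α β * t (j ∷ β)))
      ≈⟨ sumTo-cong (suc d) (λ j _ → inner j) ⟩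
    sumTo (suc d) (λ j → kronecker i j * (kronecker (Vec.sum α) (d ℕ.∸ j) * t (j ∷ α)))
      ≈⟨ outer ⟩
    kronecker (i ℕ.+ Vec.sum α) d * t (i ∷ α) ∎
    where
    inner : ∀ j → sumOver (exponents k (d ℕ.∸ j)) (λ β → kronecker i j * kroneckerᵛ α β * t (j ∷ β)) ≈
                  kronecker i j * (kronecker (Vec.sum α) (d ℕ.∸ j) * t (j ∷ α))
    inner j = begin
      sumOver (exponents k (d ℕ.∸ j)) (λ β → kronecker i j * kroneckerᵛ α β * t (j ∷ β))
        ≈⟨ sumOver-cong (exponents k (d ℕ.∸ j)) (λ β → *-assoc _ _ _) ⟩
      sumOver (exponents k (d ℕ.∸ j)) (λ β → kronecker i j * (kroneckerᵛ α β * t (j ∷ β)))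
        ≈⟨ sumOver-*ˡ (exponents k (d ℕ.∸ j)) _ _ ⟩
      kronecker i j * sumOver (exponents k (d ℕ.∸ j)) (λ β → kroneckerᵛ α β * t (j ∷ β))
        ≈⟨ *-congˡ (sumOver-kroneckerᵛ α (d ℕ.∸ j) (λ β → t (j ∷ β))) ⟩
      kronecker i j * (kronecker (Vec.sum α) (d ℕ.∸ j) * t (j ∷ α)) ∎
    outer : sumTo (suc d) (λ j → kronecker i j * (kronecker (Vec.sum α) (d ℕ.∸ j) * t (j ∷ α))) ≈
            kronecker (i ℕ.+ Vec.sum α) d * t (i ∷ α)
    -- If `i > d`, no summation index equals `i`, and the right side vanishes because the total
    -- degree exceeds `d`.
    outer with i ℕProp.≤? d
    ... | yes i≤d = trans (sumTo-kronecker (suc d) (λ j → kronecker (Vec.sum α) (d ℕ.∸ j) * t (j ∷ α)) (s≤s i≤d)) (*-congʳ (reflexive (kronecker-∸ (Vec.sum α) i≤d)))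
    ... | no  i≰d = trans
      (sumTo-0 (suc d) λ j j<1+d → trans
        (*-congʳ (reflexive (kronecker-≢ i j λ { ≡.refl → i≰d (ℕProp.≤-pred j<1+d) }))) (zeroˡ (kronecker (Vec.sum α) (d ℕ.∸ j) * t (j ∷ α))))
      (sym (trans (*-congʳ (reflexive (kronecker-≢ (i ℕ.+ Vec.sum α) d λ { ≡.refl → i≰d (ℕProp.m≤m+n i _) }))) (zeroˡ _)))

  partialSum-cong : ∀ {k} {F G : Vec ℕ k → Carrier} → (∀ α → F α ≈ G α) → ∀ x N → partialSum F x N ≈ partialSum G x N
  partialSum-cong {k} F≈G x N =
    sumOver-cong (List.upTo N) λ d → sumOver-cong (exponents k d) λ α → *-congʳ (F≈G α)

  partialSum-0 : ∀ {k} (x : Vec Carrier k) N → partialSum (λ α → 0#) x N ≈ 0#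
  partialSum-0 {k} x N = sumOver-0 (List.upTo N) λ d → sumOver-0 (exponents k d) λ α → zeroˡ _

  partialSum-+ : ∀ {k} (F G : Vec ℕ k → Carrier) x N →
    partialSum (λ α → F α + G α) x N ≈ partialSum F x N + partialSum G x N
  partialSum-+ {k} F G x N = trans
    (sumOver-cong (List.upTo N) λ d → trans
      (sumOver-cong (exponents k d) λ α → distribʳ _ _ _)
      (sumOver-+ (exponents k d) _ _))
    (sumOver-+ (List.upTo N) _ _)

  partialSum-*ˡ : ∀ {k} c (F : Vec ℕ k → Carrier) x N →
    partialSum (λ α → c * F α) x N ≈ c * partialSum F x N
  partialSum-*ˡ {k} c F x N = trans
    (sumOver-cong (List.upTo N) λ d → trans
      (sumOver-cong (exponents k d) λ α → *-assoc _ _ _)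
      (sumOver-*ˡ (exponents k d) _ _))
    (sumOver-*ˡ (List.upTo N) _ _)

  partialSum-kroneckerᵛ : ∀ {k} (α : Vec ℕ k) x N → Vec.sum α < N → partialSum (kroneckerᵛ α) x N ≈ monomial x α
  partialSum-kroneckerᵛ {k} α x N α<N = begin
    partialSum (kroneckerᵛ α) x N
      ≈⟨ sumOver-cong (List.upTo N) (λ d → sumOver-kroneckerᵛ α d (monomial x)) ⟩
    sumOver (List.upTo N) (λ d → kronecker (Vec.sum α) d * monomial x α)
      ≈⟨ sumOver-upTo N _ ⟩
    sumTo N (λ d → kronecker (Vec.sum α) d * monomial x α)
      ≈⟨ sumTo-kronecker N _ α<N ⟩
    monomial x α ∎

  partialSum₁ : ∀ (F : Vec ℕ 1 → Carrier) u N →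
    partialSum F (u ∷ []) N ≈ sumTo N (λ i → F (i ∷ []) * u ^ i)
  partialSum₁ F u N = trans (sumOver-upTo N _) (sumTo-cong N λ i _ →
    trans (sumOver-exponents₁ i _) (*-congˡ (*-identityʳ _)))

  monomial-0 : ∀ {k} (x : Vec Carrier k) → monomial x (Vec.replicate k 0) ≈ 1#
  monomial-0 []       = refl
  monomial-0 (x ∷ xs) = trans (*-identityˡ _) (monomial-0 xs)

  monomial-+ : ∀ {k} (x : Vec Carrier k) α β → monomial x (Vec.zipWith ℕ._+_ α β) ≈ monomial x α * monomial x β
  monomial-+ []       []      []      = sym (*-identityˡ 1#)
  monomial-+ (x ∷ xs) (i ∷ α) (j ∷ β) = trans (*-cong (^-homo-* x i j) (monomial-+ xs α β)) (interchange _ _ _ _)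

  unit : ∀ {k} → Fin k → Vec ℕ k
  unit Fin.zero    = 1 ∷ Vec.replicate _ 0
  unit (Fin.suc i) = 0 ∷ unit i

  monomial-unit : ∀ {k} (x : Vec Carrier k) i → monomial x (unit i) ≈ Vec.lookup x i
  monomial-unit (x ∷ xs) Fin.zero    = trans (*-cong (*-identityʳ x) (monomial-0 xs)) (*-identityʳ x)
  monomial-unit (x ∷ xs) (Fin.suc i) = trans (*-identityˡ _) (monomial-unit xs i)

  -- Polynomial expressions and their coefficients.

  data Expr (k : ℕ) : Set where
    con     : Carrier → Expr k
    var     : Fin k → Expr k
    _⊕_ _⊗_ : Expr k → Expr k → Expr k

  infixl 6 _⊕_
  infixl 7 _⊗_

  ⟦_⟧ : ∀ {k} → Expr k → Vec Carrier k → Carrier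
  ⟦ con c ⟧  x = c
  ⟦ var i ⟧  x = Vec.lookup x i
  ⟦ e ⊕ e′ ⟧ x = ⟦ e ⟧ x + ⟦ e′ ⟧ x
  ⟦ e ⊗ e′ ⟧ x = ⟦ e ⟧ x * ⟦ e′ ⟧ x

  -- Exponents may repeat; like terms are collected only by `coeff`.
  Terms : ℕ → Set
  Terms k = List (Carrier × Vec ℕ k)

  evalTerms : ∀ {k} → Terms k → Vec Carrier k → Carrier
  evalTerms T x = sumOver T λ (c , α) → c * monomial x α

  mulTerms : ∀ {k} → Terms k → Terms k → Terms k
  mulTerms S T = List.concatMap (λ (c , α) → List.map (λ (d , β) → c * d , Vec.zipWith ℕ._+_ α β) T) S

  evalTerms-mul : ∀ {k} (S T : Terms k) x → evalTerms (mulTerms S T) x ≈ evalTerms S x * evalTerms T x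
  evalTerms-mul S T x = begin
    evalTerms (mulTerms S T) x
      ≈⟨ sumOver-concatMap _ S _ ⟩
    sumOver S (λ (c , α) → evalTerms (List.map (λ (d , β) → c * d , Vec.zipWith ℕ._+_ α β) T) x)
      ≈⟨ sumOver-cong S (λ (c , α) → begin
           evalTerms (List.map (λ (d , β) → c * d , Vec.zipWith ℕ._+_ α β) T) x
             ≈⟨ reflexive (sumOver-map _ T _) ⟩
           sumOver T (λ (d , β) → c * d * monomial x (Vec.zipWith ℕ._+_ α β))
             ≈⟨ sumOver-cong T (λ (d , β) → trans (*-congˡ (monomial-+ x α β)) (interchange _ _ _ _)) ⟩
           sumOver T (λ (d , β) → c * monomial x α * (d * monomial x β))
             ≈⟨ sumOver-*ˡ T _ _ ⟩
           c * monomial x α * evalTerms T x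
             ≈⟨ *-comm _ _ ⟩
           evalTerms T x * (c * monomial x α) ∎) ⟩
    sumOver S (λ (c , α) → evalTerms T x * (c * monomial x α))
      ≈⟨ sumOver-*ˡ S _ _ ⟩
    evalTerms T x * evalTerms S x
      ≈⟨ *-comm _ _ ⟩
    evalTerms S x * evalTerms T x ∎

  terms : ∀ {k} → Expr k → Terms k
  terms (con c)  = (c , Vec.replicate _ 0) List.∷ List.[]
  terms (var i)  = (1# , unit i) List.∷ List.[]
  terms (e ⊕ e′) = terms e List.++ terms e′
  terms (e ⊗ e′) = mulTerms (terms e) (terms e′)

  evalTerms-terms : ∀ {k} (e : Expr k) x → evalTerms (terms e) x ≈ ⟦ e ⟧ x
  evalTerms-terms (con c)  x = trans (+-identityʳ _) (trans (*-congˡ (monomial-0 x)) (*-identityʳ c))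
  evalTerms-terms (var i)  x = trans (+-identityʳ _) (trans (*-identityˡ _) (monomial-unit x i))
  evalTerms-terms (e ⊕ e′) x =
    trans (sumOver-++ (terms e) (terms e′) _) (+-cong (evalTerms-terms e x) (evalTerms-terms e′ x))
  evalTerms-terms (e ⊗ e′) x =
    trans (evalTerms-mul (terms e) (terms e′) x) (*-cong (evalTerms-terms e x) (evalTerms-terms e′ x))

  coeff : ∀ {k} → Terms k → Vec ℕ k → Carrier
  coeff T β = sumOver T λ (c , α) → c * kroneckerᵛ α β

  -- A strict upper bound for the degree.

  degBound : ∀ {k} → Terms k → ℕ
  degBound List.[]            = 0
  degBound ((c , α) List.∷ T) = suc (Vec.sum α) ℕ.⊔ degBound T

  coeff-high : ∀ {k} (T : Terms k) β → degBound T ≤ Vec.sum β → coeff T β ≈ 0#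
  coeff-high List.[]            β _   = refl
  coeff-high ((c , α) List.∷ T) β T≤β = trans
    (+-cong (trans (*-congˡ (kroneckerᵛ-> α β (ℕProp.m⊔n≤o⇒m≤o (suc (Vec.sum α)) (degBound T) T≤β))) (zeroʳ c))
            (coeff-high T β (ℕProp.m⊔n≤o⇒n≤o (suc (Vec.sum α)) (degBound T) T≤β)))
    (+-identityˡ 0#)

  -- Linearity reduces this to single monomials, where `partialSum-kroneckerᵛ` applies. It turns a
  -- polynomial into a power series with the same values.
  partialSum-coeff : ∀ {k} (T : Terms k) x N → degBound T ≤ N → partialSum (coeff T) x N ≈ evalTerms T x
  partialSum-coeff List.[]            x N _   = partialSum-0 x N
  partialSum-coeff ((c , α) List.∷ T) x N T≤N = begin
    partialSum (coeff ((c , α) List.∷ T)) x N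
      ≈⟨ partialSum-+ _ _ x N ⟩
    partialSum (λ β → c * kroneckerᵛ α β) x N + partialSum (coeff T) x N
      ≈⟨ +-cong (partialSum-*ˡ c (kroneckerᵛ α) x N) (partialSum-coeff T x N (ℕProp.m⊔n≤o⇒n≤o (suc (Vec.sum α)) (degBound T) T≤N)) ⟩
    c * partialSum (kroneckerᵛ α) x N + evalTerms T x
      ≈⟨ +-congʳ (*-congˡ (partialSum-kroneckerᵛ α x N (ℕProp.m⊔n≤o⇒m≤o (suc (Vec.sum α)) (degBound T) T≤N))) ⟩
    c * monomial x α + evalTerms T x ∎

-- Rings with a Fermat quotient, and the expansion of δ.

module _ (R : CommutativeRing 0ℓ 0ℓ) where

  open CommutativeRing R
  open Algebra.Properties.Semiring.Exp semiring

  -- The algebraic properties of the p-adic integers: p can be cancelled, δ is the Fermat quotient,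
  -- and every element is a multiple of p or satisfies Fermat's little theorem modulo p.
  -- Completeness and the finite residue systems enter only in `Main`.
  module DeltaRing
    (fromℤ : ℤ → Carrier)
    (+-homo : ∀ a b → fromℤ (a ℤ.+ b) ≈ fromℤ a + fromℤ b)
    (*-homo : ∀ a b → fromℤ (a ℤ.* b) ≈ fromℤ a * fromℤ b)
    (-‿homo : ∀ a → fromℤ (ℤ.- a) ≈ - fromℤ a)
    (0-homo : fromℤ 0ℤ ≈ 0#)
    (1-homo : fromℤ 1ℤ ≈ 1#)
    (p : ℕ) (p-prime : Prime p)
    (*-cancelˡ-p : ∀ x y → fromℤ (+ p) * x ≈ fromℤ (+ p) * y → x ≈ y)
    (δ : Carrier → Carrier)
    (δ-cong : ∀ a b → a ≈ b → δ a ≈ δ b)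
    (δ-spec : ∀ a → fromℤ (+ p) * δ a ≈ a - a ^ p)
    (p∣⊎p∣1-^ : ∀ x → (∃[ y ] x ≈ fromℤ (+ p) * y) ⊎ (∃[ y ] 1# - x ^ pred p ≈ fromℤ (+ p) * y))
    where

    π : Carrier
    π = fromℤ (+ p)

    open Algebra.Properties.Ring ring using (-1*x≈-x; -0#≈0#; +-cancelˡ)
    open Relation.Binary.Reasoning.Setoid setoid

    private
      ι : ℤ.+-*-rawRing -Raw-AlmostCommutative⟶ fromCommutativeRing R
      ι = record
        { ⟦_⟧    = fromℤ
        ; +-homo = +-homo
        ; *-homo = *-homo
        ; -‿homo = -‿homo
        ; 0-homo = 0-homo
        ; 1-homo = 1-homo
        }

      fromℤ-≟ : (a b : ℤ) → Maybe (fromℤ a ≈ fromℤ b)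
      fromℤ-≟ a b with a ℤProp.≟ b
      ... | yes ≡.refl = just refl
      ... | no _       = nothing

    open Algebra.Solver.Ring ℤ.+-*-rawRing (fromCommutativeRing R) ι fromℤ-≟
      using (solve; _:=_; _:+_; _:*_; _:-_; :-_) renaming (con to :con)

    open FiniteSums R
    open Polynomials R p p-prime

    p>1 : 1 < p
    p>1 = ℕ.nonTrivial⇒n>1 p ⦃ prime⇒nonTrivial p-prime ⦄

    -- The second-order remainder in (c + πt)ⁿ = cⁿ + πt(ncⁿ⁻¹ + π·binomialRest n c t);
    -- the junk value pred 0 = 0 is harmless since it is multiplied by n = 0.

    binomialRest : ℕ → Carrier → Carrier → Carrier
    binomialRest zero    c t = 0#
    binomialRest (suc n) c t =
      c * binomialRest n c t + t * (fromℤ (+ n) * c ^ pred n + π * binomialRest n c t)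

    binomial-expand : ∀ n c t →
      (c + π * t) ^ n ≈ c ^ n + π * t * (fromℤ (+ n) * c ^ pred n + π * binomialRest n c t)
    binomial-expand zero c t = sym (begin
      1# + π * t * (fromℤ 0ℤ * 1# + π * 0#) ≈⟨ +-congˡ (*-congˡ (+-cong (*-congʳ 0-homo) (zeroʳ π))) ⟩
      1# + π * t * (0# * 1# + 0#)           ≈⟨ +-congˡ (*-congˡ (trans (+-identityʳ _) (zeroˡ 1#))) ⟩
      1# + π * t * 0#                       ≈⟨ +-congˡ (zeroʳ _) ⟩
      1# + 0#                               ≈⟨ +-identityʳ 1# ⟩
      1#                                    ∎)
    binomial-expand (suc n) c t = begin
      (c + π * t) * (c + π * t) ^ n
        ≈⟨ *-congˡ (binomial-expand n c t) ⟩
      (c + π * t) * (c ^ n + π * t * (fromℤ (+ n) * c ^ pred n + π * r))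
        ≈⟨ solve 7 (λ c π t cⁿ n d r →
             (c :+ π :* t) :* (cⁿ :+ π :* t :* (n :* d :+ π :* r)) :=
             c :* cⁿ :+ π :* t :* (n :* (c :* d) :+ cⁿ :+ π :* (c :* r :+ t :* (n :* d :+ π :* r))))
             refl c π t (c ^ n) (fromℤ (+ n)) (c ^ pred n) r ⟩
      c ^ suc n + π * t * (fromℤ (+ n) * (c * c ^ pred n) + c ^ n + π * binomialRest (suc n) c t)
        ≈⟨ +-congˡ (*-congˡ (+-congʳ (+-congʳ (n*c*cⁿ⁻¹ n)))) ⟩
      c ^ suc n + π * t * (fromℤ (+ n) * c ^ n + c ^ n + π * binomialRest (suc n) c t)
        ≈⟨ +-congˡ (*-congˡ (+-congʳ collect)) ⟩
      c ^ suc n + π * t * (fromℤ (+ suc n) * c ^ n + π * binomialRest (suc n) c t) ∎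
      where
      r = binomialRest n c t
      -- For `n = 0` the powers are `c` and `1`; they agree only after multiplication by `fromℤ 0`.
      n*c*cⁿ⁻¹ : ∀ n → fromℤ (+ n) * (c * c ^ pred n) ≈ fromℤ (+ n) * c ^ n
      n*c*cⁿ⁻¹ zero    = trans (*-congʳ 0-homo) (trans (zeroˡ _) (sym (trans (*-congʳ 0-homo) (zeroˡ _))))
      n*c*cⁿ⁻¹ (suc n) = refl
      collect : fromℤ (+ n) * c ^ n + c ^ n ≈ fromℤ (+ suc n) * c ^ n
      collect = begin
        fromℤ (+ n) * c ^ n + c ^ n          ≈⟨ solve 2 (λ n d → n :* d :+ d := (:con 1ℤ :+ n) :* d) refl _ _ ⟩
        (fromℤ 1ℤ + fromℤ (+ n)) * c ^ n     ≈⟨ *-congʳ (+-homo 1ℤ (+ n)) ⟨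
        fromℤ (+ suc n) * c ^ n              ∎

    -- For `n = p` the linear coefficient in `binomial-expand` is also divisible by π, so
    -- `(c + πt)^p - c^p` is `π²t` times this cofactor.
    δ-slope : Carrier → Carrier → Carrier
    δ-slope c t = c ^ pred p + binomialRest p c t

    -- After multiplication by π, `δ-spec` makes this an identity about `(c + πt)^p`. The linear
    -- term `πt` loses one factor π in the division, while the p-th power contributes only a
    -- correction still divisible by π.
    δ-expand : ∀ c t → δ (c + π * t) ≈ δ c + (t - π * (t * δ-slope c t))
    δ-expand c t = *-cancelˡ-p _ _ (begin
      π * δ (c + π * t)
        ≈⟨ δ-spec (c + π * t) ⟩
      c + π * t - (c + π * t) ^ p
        ≈⟨ +-congˡ (-‿cong (binomial-expand p c t)) ⟩
      c + π * t - (c ^ p + π * t * (π * c ^ pred p + π * binomialRest p c t))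
        ≈⟨ solve 6 (λ c π t cᵖ d r →
             c :+ π :* t :- (cᵖ :+ π :* t :* (π :* d :+ π :* r)) :=
             (c :- cᵖ) :+ π :* (t :- π :* (t :* (d :+ r)))) refl c π t (c ^ p) (c ^ pred p) (binomialRest p c t) ⟩
      (c - c ^ p) + π * (t - π * (t * δ-slope c t))
        ≈⟨ +-congʳ (δ-spec c) ⟨
      π * δ c + π * (t - π * (t * δ-slope c t))
        ≈⟨ distribˡ π _ _ ⟨
      π * (δ c + (t - π * (t * δ-slope c t))) ∎)

    -- Differences, powers and substitution for polynomial expressions.

    infixl 6 _⊖_
    infixr 8 _⊛_

    _⊖_ : ∀ {k} → Expr k → Expr k → Expr k
    e ⊖ e′ = e ⊕ con (- 1#) ⊗ e′

    _⊛_ : ∀ {k} → Expr k → ℕ → Expr k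
    e ⊛ zero  = con 1#
    e ⊛ suc n = e ⊗ (e ⊛ n)

    ⟦⟧-cong : ∀ {k} (e : Expr k) {x y} → Pointwise _≈_ x y → ⟦ e ⟧ x ≈ ⟦ e ⟧ y
    ⟦⟧-cong (con c)  x≈y = refl
    ⟦⟧-cong (var i)  x≈y = Pointwise.lookup x≈y i
    ⟦⟧-cong (e ⊕ e′) x≈y = +-cong (⟦⟧-cong e x≈y) (⟦⟧-cong e′ x≈y)
    ⟦⟧-cong (e ⊗ e′) x≈y = *-cong (⟦⟧-cong e x≈y) (⟦⟧-cong e′ x≈y)

    ⟦⊖⟧ : ∀ {k} (e e′ : Expr k) x → ⟦ e ⊖ e′ ⟧ x ≈ ⟦ e ⟧ x - ⟦ e′ ⟧ x
    ⟦⊖⟧ e e′ x = +-congˡ (-1*x≈-x _)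

    ⟦⊛⟧ : ∀ {k} (e : Expr k) n x → ⟦ e ⊛ n ⟧ x ≈ ⟦ e ⟧ x ^ n
    ⟦⊛⟧ e zero    x = refl
    ⟦⊛⟧ e (suc n) x = *-congˡ (⟦⊛⟧ e n x)

    _[_] : ∀ {k l} → Expr k → Vec (Expr l) k → Expr l
    con c    [ es ] = con c
    var i    [ es ] = Vec.lookup es i
    (e ⊕ e′) [ es ] = (e [ es ]) ⊕ (e′ [ es ])
    (e ⊗ e′) [ es ] = (e [ es ]) ⊗ (e′ [ es ])

    ⟦[]⟧ : ∀ {k l} (e : Expr k) {es : Vec (Expr l) k} {x y} →
           Pointwise (λ e′ y′ → ⟦ e′ ⟧ x ≈ y′) es y → ⟦ e [ es ] ⟧ x ≈ ⟦ e ⟧ y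
    ⟦[]⟧ (con c)  es≈y = refl
    ⟦[]⟧ (var i)  es≈y = Pointwise.lookup es≈y i
    ⟦[]⟧ (e ⊕ e′) es≈y = +-cong (⟦[]⟧ e es≈y) (⟦[]⟧ e′ es≈y)
    ⟦[]⟧ (e ⊗ e′) es≈y = *-cong (⟦[]⟧ e es≈y) (⟦[]⟧ e′ es≈y)

    weaken : ∀ {k} → Expr k → Expr (suc k)
    weaken (con c)  = con c
    weaken (var i)  = var (Fin.suc i)
    weaken (e ⊕ e′) = weaken e ⊕ weaken e′
    weaken (e ⊗ e′) = weaken e ⊗ weaken e′

    ⟦weaken⟧ : ∀ {k} (e : Expr k) x xs → ⟦ weaken e ⟧ (x ∷ xs) ≈ ⟦ e ⟧ xs
    ⟦weaken⟧ (con c)  x xs = refl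
    ⟦weaken⟧ (var i)  x xs = refl
    ⟦weaken⟧ (e ⊕ e′) x xs = +-cong (⟦weaken⟧ e x xs) (⟦weaken⟧ e′ x xs)
    ⟦weaken⟧ (e ⊗ e′) x xs = *-cong (⟦weaken⟧ e x xs) (⟦weaken⟧ e′ x xs)

    -- Polynomial functions of one variable and their congruence modulo π.

    ⟦_⟧₁ : Expr 1 → Carrier → Carrier
    ⟦ e ⟧₁ u = ⟦ e ⟧ (u ∷ [])

    -- The expression is kept as data because `∼-*` has to write down a remainder built from it.
    record IsPoly (f : Carrier → Carrier) : Set where
      constructor poly
      field
        expr    : Expr 1
        expr-eq : ∀ u → f u ≈ ⟦ expr ⟧₁ u

    open IsPoly

    poly-expr : ∀ e → IsPoly ⟦ e ⟧₁
    poly-expr e = poly e (λ u → refl)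

    poly-id : IsPoly (λ u → u)
    poly-id = poly-expr (var Fin.zero)

    poly-con : ∀ c → IsPoly (λ u → c)
    poly-con c = poly-expr (con c)

    poly-+ : ∀ {f g} → IsPoly f → IsPoly g → IsPoly (λ u → f u + g u)
    poly-+ (poly e f≈e) (poly e′ g≈e′) = poly (e ⊕ e′) (λ u → +-cong (f≈e u) (g≈e′ u))

    poly-* : ∀ {f g} → IsPoly f → IsPoly g → IsPoly (λ u → f u * g u)
    poly-* (poly e f≈e) (poly e′ g≈e′) = poly (e ⊗ e′) (λ u → *-cong (f≈e u) (g≈e′ u))

    poly-neg : ∀ {f} → IsPoly f → IsPoly (λ u → - f u)
    poly-neg (poly e f≈e) =
      poly (con (- 1#) ⊗ e) (λ u → trans (-‿cong (f≈e u)) (sym (-1*x≈-x _)))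

    poly-binomialRest : ∀ n c {f} → IsPoly f → IsPoly (λ u → binomialRest n c (f u))
    poly-binomialRest zero    c f-poly = poly-con 0#
    poly-binomialRest (suc n) c f-poly =
      poly-+ (poly-* (poly-con c) r-poly)
             (poly-* f-poly (poly-+ (poly-con _) (poly-* (poly-con π) r-poly)))
      where r-poly = poly-binomialRest n c f-poly

    -- f ∼ g is congruence modulo π as polynomials: π times a polynomial function
    -- separates them, which is stronger than a congruence of all values.

    infix 4 _∼_

    record _∼_ (f g : Carrier → Carrier) : Set where
      constructor mk∼
      field
        rest    : Expr 1
        rest-eq : ∀ u → f u ≈ g u + π * ⟦ rest ⟧₁ u

    open _∼_

    ∼-reflexive : ∀ {f g} → (∀ u → f u ≈ g u) → f ∼ g
    ∼-reflexive f≈g = mk∼ (con 0#) λ u →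
      trans (f≈g u) (sym (trans (+-congˡ (zeroʳ π)) (+-identityʳ _)))

    ∼-trans : ∀ {f g h} → f ∼ g → g ∼ h → f ∼ h
    ∼-trans {f} {g} {h} (mk∼ r f≈) (mk∼ s g≈) = mk∼ (s ⊕ r) λ u → begin
      f u                                     ≈⟨ f≈ u ⟩
      g u + π * ⟦ r ⟧₁ u                      ≈⟨ +-congʳ (g≈ u) ⟩
      (h u + π * ⟦ s ⟧₁ u) + π * ⟦ r ⟧₁ u     ≈⟨ +-assoc _ _ _ ⟩
      h u + (π * ⟦ s ⟧₁ u + π * ⟦ r ⟧₁ u)     ≈⟨ +-congˡ (distribˡ π _ _) ⟨
      h u + π * (⟦ s ⟧₁ u + ⟦ r ⟧₁ u)         ∎

    ∼-+ : ∀ {f f′ g g′} → f ∼ f′ → g ∼ g′ → (λ u → f u + g u) ∼ (λ u → f′ u + g′ u)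
    ∼-+ (mk∼ r f≈) (mk∼ s g≈) = mk∼ (r ⊕ s) λ u → trans (+-cong (f≈ u) (g≈ u))
      (solve 5 (λ f g π r s → (f :+ π :* r) :+ (g :+ π :* s) := (f :+ g) :+ π :* (r :+ s)) refl _ _ _ _ _)

    -- Multiplying out `(f′ + πr)(g′ + πs)` produces the cross terms `f′s` and `g′r`; with `f′` and
    -- `g′` polynomial, the remainder is polynomial too.
    ∼-* : ∀ {f f′ g g′} → IsPoly f′ → IsPoly g′ → f ∼ f′ → g ∼ g′ →
          (λ u → f u * g u) ∼ (λ u → f′ u * g′ u)
    ∼-* (poly a f′≈) (poly b g′≈) (mk∼ r f≈) (mk∼ s g≈) =
      mk∼ (a ⊗ s ⊕ b ⊗ r ⊕ con π ⊗ (r ⊗ s)) λ u →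
        trans (*-cong (f≈ u) (g≈ u)) (trans
          (solve 5 (λ f g π r s →
            (f :+ π :* r) :* (g :+ π :* s) := f :* g :+ π :* (f :* s :+ g :* r :+ π :* (r :* s)))
            refl _ _ _ _ _)
          (+-congˡ (*-congˡ (+-congʳ (+-cong (*-congʳ (f′≈ u)) (*-congʳ (g′≈ u)))))))

    ∼-^ : ∀ n {f g} → IsPoly g → f ∼ g → (λ u → f u ^ n) ∼ (λ u → g u ^ n)
    poly-^ : ∀ n {f} → IsPoly f → IsPoly (λ u → f u ^ n)
    poly-^ zero    f-poly = poly-con 1#
    poly-^ (suc n) f-poly = poly-* f-poly (poly-^ n f-poly)
    ∼-^ zero    g-poly f∼g = ∼-reflexive λ u → refl
    ∼-^ (suc n) g-poly f∼g = ∼-* g-poly (poly-^ n g-poly) f∼g (∼-^ n g-poly f∼g)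

    ∼-neg : ∀ {f g} → f ∼ g → (λ u → - f u) ∼ (λ u → - g u)
    ∼-neg (mk∼ r f≈) = mk∼ (con (- 1#) ⊗ r) λ u → trans (-‿cong (f≈ u)) (trans
      (solve 3 (λ g π r → :- (g :+ π :* r) := :- g :+ π :* :- r) refl _ _ _)
      (+-congˡ (*-congˡ (sym (-1*x≈-x _)))))

    poly-∘ : ∀ e {f} → IsPoly f → IsPoly (λ u → ⟦ e ⟧₁ (f u))
    poly-∘ e (poly e′ f≈) = poly (e [ e′ ∷ [] ]) λ u → sym (⟦[]⟧ e (sym (f≈ u) ∷ []))

    ∼-∘ : ∀ e {f g} → IsPoly g → f ∼ g → (λ u → ⟦ e ⟧₁ (f u)) ∼ (λ u → ⟦ e ⟧₁ (g u))
    ∼-∘ (con c)        g-poly f∼g = ∼-reflexive λ u → refl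
    ∼-∘ (var Fin.zero) g-poly f∼g = f∼g
    ∼-∘ (e ⊕ e′)       g-poly f∼g = ∼-+ (∼-∘ e g-poly f∼g) (∼-∘ e′ g-poly f∼g)
    ∼-∘ (e ⊗ e′)       g-poly f∼g =
      ∼-* (poly-∘ e g-poly) (poly-∘ e′ g-poly) (∼-∘ e g-poly f∼g) (∼-∘ e′ g-poly f∼g)

    ∼id⇒poly : ∀ {f} → f ∼ (λ u → u) → IsPoly f
    ∼id⇒poly (mk∼ r f≈) = poly (var Fin.zero ⊕ con π ⊗ r) f≈

    -- The action of δ on balls.

    δ*-cong : ∀ n {a b} → a ≈ b → Pointwise _≈_ (Vec.iterate δ a n) (Vec.iterate δ b n)
    δ*-cong zero    a≈b = []
    δ*-cong (suc n) a≈b = a≈b ∷ δ*-cong n (δ-cong _ _ a≈b)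

    -- The scaled coordinate, about `δ b` and at scale `π ^ m`, of the image under δ of the point
    -- with coordinate `x` about `b` at scale `π ^ suc m`. The correction in `δ-expand` contains
    -- `t = π ^ m * x` as a factor, so it survives the rescaling and is still a multiple of π.
    δ-ball-shift : ∀ m → Carrier → Carrier → Carrier
    δ-ball-shift m b x = x - π * (x * δ-slope b (π ^ m * x))

    δ-ball : ∀ m b x → δ (b + π ^ suc m * x) ≈ δ b + π ^ m * δ-ball-shift m b x
    δ-ball m b x = begin
      δ (b + π ^ suc m * x)
        ≈⟨ δ-cong _ _ (+-congˡ (*-assoc π (π ^ m) x)) ⟩
      δ (b + π * (π ^ m * x))
        ≈⟨ δ-expand b (π ^ m * x) ⟩
      δ b + (π ^ m * x - π * ((π ^ m * x) * s))
        ≈⟨ +-congˡ (solve 4 (λ πᵐ x π s →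
             πᵐ :* x :- π :* ((πᵐ :* x) :* s) := πᵐ :* (x :- π :* (x :* s))) refl (π ^ m) x π s) ⟩
      δ b + π ^ m * δ-ball-shift m b x ∎
      where s = δ-slope b (π ^ m * x)

    poly-δ-ball-slope : ∀ m b {v} → IsPoly v → IsPoly (λ u → v u * δ-slope b (π ^ m * v u))
    poly-δ-ball-slope m b v-poly = poly-* v-poly
      (poly-+ (poly-con _) (poly-binomialRest p b (poly-* (poly-con _) v-poly)))

    poly-δ-ball-shift : ∀ m b {v} → IsPoly v → IsPoly (λ u → δ-ball-shift m b (v u))
    poly-δ-ball-shift m b v-poly =
      poly-+ v-poly (poly-neg (poly-* (poly-con π) (poly-δ-ball-slope m b v-poly)))

    δ-ball-shift∼ : ∀ m b {v} → IsPoly v → (λ u → δ-ball-shift m b (v u)) ∼ v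
    δ-ball-shift∼ m b v-poly = mk∼ (con (- 1#) ⊗ expr s) λ u → +-congˡ (begin
      - (π * _)                            ≈⟨ -‿cong (*-congˡ (expr-eq s u)) ⟩
      - (π * ⟦ expr s ⟧₁ u)                ≈⟨ solve 2 (λ π s → :- (π :* s) := π :* :- s) refl _ _ ⟩
      π * - ⟦ expr s ⟧₁ u                  ≈⟨ *-congˡ (-1*x≈-x _) ⟨
      π * (- 1# * ⟦ expr s ⟧₁ u)           ∎)
      where s = poly-δ-ball-slope m b v-poly

    -- Expressions cannot divide by π, but each application of δ spends one factor π of the radius
    -- instead, so `m` applications remain polynomial on a ball of scale `π ^ m`. A general `v` is
    -- needed because every application changes the coordinate.
    δ*-poly : ∀ m b {v} → IsPoly v → Σ[ es ∈ Vec (Expr 1) (suc m) ]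
      ∀ u → Pointwise (λ e x → ⟦ e ⟧₁ u ≈ x) es (Vec.iterate δ (b + π ^ m * v u) (suc m))
    δ*-poly zero    b {v} v-poly = expr w ∷ [] , λ u → sym (expr-eq w u) ∷ []
      where w = poly-+ (poly-con b) (poly-* (poly-con _) v-poly)
    δ*-poly (suc m) b {v} v-poly =
      let es , es≈ = δ*-poly m (δ b) (poly-δ-ball-shift m b v-poly) in
      expr w ∷ es , λ u → sym (expr-eq w u) ∷
        Pointwise.trans trans (es≈ u) (δ*-cong (suc m) (sym (δ-ball m b (v u))))
      where w = poly-+ (poly-con b) (poly-* (poly-con _) v-poly)

    -- Indicators of balls modulo π.

    -- 1 - (x₀ - c)ᵖ⁻¹ is, modulo π, the indicator of the residue class of c.

    window : ∀ {k} → Carrier → Expr (suc k)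
    window c = con 1# ⊖ (var Fin.zero ⊖ con c) ⊛ pred p

    ⟦window⟧ : ∀ {k} c x (xs : Vec Carrier k) → ⟦ window c ⟧ (x ∷ xs) ≈ 1# - (x - c) ^ pred p
    ⟦window⟧ c x xs = trans (⟦⊖⟧ (con 1#) ((var Fin.zero ⊖ con c) ⊛ pred p) (x ∷ xs)) (+-congˡ (-‿cong
      (trans (⟦⊛⟧ (var Fin.zero ⊖ con c) (pred p) (x ∷ xs)) (^-congˡ (pred p) (⟦⊖⟧ (var Fin.zero) (con c) (x ∷ xs))))))

    -- A ball of scale `π ^ suc m` lies in one residue class modulo π, so the window sees only its
    -- centre.
    window-ball : ∀ m b c {v} → IsPoly v →
      (λ u → 1# - ((b + π ^ suc m * v u) - c) ^ pred p) ∼ (λ u → 1# - (b - c) ^ pred p)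
    window-ball m b c {v} v-poly =
      ∼-+ (∼-reflexive λ u → refl) (∼-neg (∼-^ (pred p) (poly-con (b - c)) (mk∼ (expr w) λ u → begin
        b + π * π ^ m * v u - c
          ≈⟨ solve 5 (λ b π πᵐ v c → b :+ π :* πᵐ :* v :- c := (b :- c) :+ π :* (πᵐ :* v)) refl _ _ _ _ _ ⟩
        (b - c) + π * (π ^ m * v u)
          ≈⟨ +-congˡ (*-congˡ (expr-eq w u)) ⟩
        (b - c) + π * ⟦ expr w ⟧₁ u ∎)))
      where w = poly-* (poly-con (π ^ m)) v-poly

    -- Modulo π, onBall m c q equals q(u) at c + πᵐu and vanishes on the other
    -- balls of radius πᵐ, as a polynomial in (a, δa, …, δᵐa).

    onBall : ∀ m → Carrier → Expr 1 → Expr (suc m)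
    onBall zero    c q = q [ var Fin.zero ⊖ con c ∷ [] ]
    onBall (suc m) c q = window c ⊗ weaken (onBall m (δ c) q)

    onBall-δ : ∀ m b c q {v : Carrier → Carrier} u →
      ⟦ weaken (onBall m c q) ⟧ (Vec.iterate δ (b + π ^ suc m * v u) (suc (suc m))) ≈
      ⟦ onBall m c q ⟧ (Vec.iterate δ (δ b + π ^ m * δ-ball-shift m b (v u)) (suc m))
    onBall-δ m b c q {v} u =
      trans (⟦weaken⟧ (onBall m c q) _ _) (⟦⟧-cong (onBall m c q) (δ*-cong (suc m) (δ-ball m b (v u))))

    -- Induction on `m`: the window at its own centre is 1 modulo π, and the other factor is the
    -- same claim for the ball about `δ c`. The coordinate is only required to be `u` modulo π,
    -- since δ alters it by multiples of π.
    onBall-inside : ∀ m c q {v} → v ∼ (λ u → u) →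
      (λ u → ⟦ onBall m c q ⟧ (Vec.iterate δ (c + π ^ m * v u) (suc m))) ∼ ⟦ q ⟧₁
    onBall-inside zero c q {v} v∼id =
      ∼-trans (∼-reflexive λ u → ⟦[]⟧ q (in-window u ∷ [])) (∼-∘ q poly-id v∼id)
      where
      in-window : ∀ u → ⟦ var Fin.zero ⊖ con c ⟧ (c + 1# * v u ∷ []) ≈ v u
      in-window u = trans (⟦⊖⟧ (var Fin.zero) (con c) (c + 1# * v u ∷ []))
        (trans (+-congʳ (+-congˡ (*-identityˡ _))) (solve 2 (λ c v → c :+ v :- c := v) refl c (v u)))
    onBall-inside (suc m) c q {v} v∼id = ∼-trans
      (∼-* (poly-con 1#) (poly-expr q)
        (∼-trans (∼-reflexive λ u → ⟦window⟧ c _ _)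
          (∼-trans (window-ball m c c v-poly) (∼-reflexive λ u → at-center)))
        (∼-trans (∼-reflexive (onBall-δ m c (δ c) q {v}))
          (onBall-inside m (δ c) q (∼-trans (δ-ball-shift∼ m c v-poly) v∼id))))
      (∼-reflexive λ u → *-identityˡ _)
      where
      v-poly = ∼id⇒poly v∼id
      -- `p > 1` makes the exponent `pred p` positive; the zeroth power of 0 would be 1.
      0^ : ∀ n → 0 < n → 0# ^ n ≈ 0#
      0^ (suc n) _ = zeroˡ _
      at-center : 1# - (c - c) ^ pred p ≈ 1#
      at-center = begin
        1# - (c - c) ^ pred p ≈⟨ +-congˡ (-‿cong (trans (^-congˡ (pred p) (-‿inverseʳ c)) (0^ (pred p) (ℕProp.pred-mono-≤ p>1)))) ⟩
        1# - 0#               ≈⟨ +-congˡ -0#≈0# ⟩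
        1# + 0#               ≈⟨ +-identityʳ 1# ⟩
        1#                    ∎

    -- In a complete ring one would divide by the unit `1 - πh`. Here the equation is instead solved
    -- as `t = π(th + π ^ m z)`, and the cofactor of π satisfies the same equation with one power of
    -- π less.
    unit-cancel : ∀ m t h z → t - π * (t * h) ≈ π ^ m * z → ∃[ s ] t ≈ π ^ m * s
    unit-cancel zero    t h z _  = t , sym (*-identityˡ t)
    unit-cancel (suc m) t h z eq = let s , t′≈ = unit-cancel m t′ h z (*-cancelˡ-p _ _ eq′) in s , (begin
      t                   ≈⟨ t≈πt′ ⟩
      π * t′              ≈⟨ *-congˡ t′≈ ⟩
      π * (π ^ m * s)     ≈⟨ *-assoc π (π ^ m) s ⟨
      π ^ suc m * s       ∎)
      where
      t′ = t * h + π ^ m * z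
      t≈πt′ : t ≈ π * t′
      t≈πt′ = begin
        t                                     ≈⟨ solve 3 (λ t π h → t := (t :- π :* (t :* h)) :+ π :* (t :* h)) refl t π h ⟩
        (t - π * (t * h)) + π * (t * h)       ≈⟨ +-congʳ eq ⟩
        π * π ^ m * z + π * (t * h)           ≈⟨ solve 5 (λ π πᵐ z t h → π :* πᵐ :* z :+ π :* (t :* h) := π :* (t :* h :+ πᵐ :* z)) refl _ _ _ _ _ ⟩
        π * t′                                ∎
      eq′ : π * (t′ - π * (t′ * h)) ≈ π * (π ^ m * z)
      eq′ = begin
        π * (t′ - π * (t′ * h))             ≈⟨ solve 3 (λ π t h → π :* (t :- π :* (t :* h)) := π :* t :- π :* (π :* t :* h)) refl π t′ h ⟩
        π * t′ - π * (π * t′ * h)           ≈⟨ +-cong t≈πt′ (-‿cong (*-congˡ (*-congʳ t≈πt′))) ⟨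
        t - π * (t * h)                     ≈⟨ eq ⟩
        π * π ^ m * z                       ≈⟨ *-assoc π (π ^ m) z ⟩
        π * (π ^ m * z)                     ∎

    -- By `δ-expand`, the difference of `δ b` and `δ c` is `t` times a factor congruent to 1 modulo
    -- π, so its divisibility by `π ^ m` passes to `t`.
    δ-separates : ∀ m {b c t} → b - c ≈ π * t → ∃[ z ] δ b ≈ δ c + π ^ m * z → ∃[ s ] b ≈ c + π ^ suc m * s
    δ-separates m {b} {c} {t} b-c≈πt (z , δb≈) =
      let s , t≈ = unit-cancel m t (δ-slope c t) z (+-cancelˡ (δ c) _ _ δ-eq) in s , (begin
        b                     ≈⟨ b≈ ⟩
        c + π * t             ≈⟨ +-congˡ (*-congˡ t≈) ⟩
        c + π * (π ^ m * s)   ≈⟨ +-congˡ (*-assoc π (π ^ m) s) ⟨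
        c + π ^ suc m * s     ∎)
      where
      b≈ : b ≈ c + π * t
      b≈ = trans (solve 2 (λ b c → b := c :+ (b :- c)) refl b c) (+-congˡ b-c≈πt)
      δ-eq : δ c + (t - π * (t * δ-slope c t)) ≈ δ c + π ^ m * z
      δ-eq = begin
        δ c + (t - π * (t * δ-slope c t)) ≈⟨ δ-expand c t ⟨
        δ (c + π * t)                     ≈⟨ δ-cong _ _ b≈ ⟨
        δ b                               ≈⟨ δb≈ ⟩
        δ c + π ^ m * z                   ∎

    -- An alternative, so that the only test needed is `p∣⊎p∣1-^`, applied in turn to `b - c`, to
    -- `δ b - δ c`, and so on. The first failure makes the corresponding window vanish modulo π; if
    -- there is none, `δ-separates` leads back to a common ball.
    onBall-outside : ∀ m b c → (∃[ z ] b ≈ c + π ^ m * z) ⊎ (∀ q {v} → IsPoly v →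
      (λ u → ⟦ onBall m c q ⟧ (Vec.iterate δ (b + π ^ m * v u) (suc m))) ∼ (λ u → 0#))
    -- At radius 1 there is only one ball.
    onBall-outside zero b c = inj₁ (b - c , trans (solve 2 (λ b c → b := c :+ (b :- c)) refl b c) (+-congˡ (sym (*-identityˡ _))))
    onBall-outside (suc m) b c with p∣⊎p∣1-^ (b - c)
    ... | inj₂ (y , ≈πy) = inj₂ λ q {v} v-poly →
      -- The factor beside the vanishing window must be polynomial in `u` for `∼-*`; `δ*-poly`
      -- supplies its expression.
      let es , es≈ = δ*-poly (suc m) b v-poly in
      ∼-trans
        (∼-* (poly-con 0#) (poly (weaken (onBall m (δ c) q) [ es ]) λ u → sym (⟦[]⟧ (weaken (onBall m (δ c) q)) (es≈ u)))
          (∼-trans (∼-reflexive λ u → ⟦window⟧ c _ _) (∼-trans (window-ball m b c v-poly)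
            (mk∼ (con y) λ u → trans ≈πy (sym (+-identityˡ _)))))
          (∼-reflexive λ u → refl))
        (∼-reflexive λ u → zeroˡ _)
    ... | inj₁ (t , b-c≈πt) with onBall-outside m (δ b) (δ c)
    ...   | inj₁ δb≡δc = inj₁ (δ-separates m b-c≈πt δb≡δc)
    ...   | inj₂ vanishes = inj₂ λ q {v} v-poly →
      ∼-trans
        (∼-* (poly-con _) (poly-con 0#)
          (∼-trans (∼-reflexive λ u → ⟦window⟧ c _ _) (window-ball m b c v-poly))
          (∼-trans (∼-reflexive (onBall-δ m b (δ c) q {v})) (vanishes q (poly-δ-ball-shift m b v-poly))))
        (∼-reflexive λ u → zeroʳ _)

    -- Interpolation on all balls and expansion in powers of π.

    πSum : (ℕ → Carrier) → ℕ → Carrier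
    πSum t zero    = 0#
    πSum t (suc n) = πSum t n + π ^ n * t n

    πSum-cong : ∀ n {s t : ℕ → Carrier} → (∀ j → s j ≈ t j) → πSum s n ≈ πSum t n
    πSum-cong zero    s≈t = refl
    πSum-cong (suc n) s≈t = +-cong (πSum-cong n s≈t) (*-congˡ (s≈t n))

    -- The numbers below `N` serve as centres of the balls; in `Main`, `N` is `p ^ m`.
    module _ (m N : ℕ)
      (distinct : ∀ {b c} → b < N → c < N → ∃[ z ] fromℤ (+ b) ≈ fromℤ (+ c) + π ^ m * z → b ≡ c) where

      δ*-ball : ℕ → Carrier → Vec Carrier (suc m)
      δ*-ball b u = Vec.iterate δ (fromℤ (+ b) + π ^ m * u) (suc m)

      onBalls : (ℕ → Expr 1) → ℕ → Expr (suc m)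
      onBalls q zero    = con 0#
      onBalls q (suc k) = onBalls q k ⊕ onBall m (fromℤ (+ k)) (q k)

      onBall-distinct : ∀ {b c} q → b < N → c < N → ¬ b ≡ c → (λ u → ⟦ onBall m (fromℤ (+ c)) q ⟧ (δ*-ball b u)) ∼ (λ u → 0#)
      onBall-distinct {b} {c} q b<N c<N b≢c with onBall-outside m (fromℤ (+ b)) (fromℤ (+ c))
      ... | inj₁ same     = contradiction (distinct b<N c<N same) b≢c
      ... | inj₂ vanishes = vanishes q poly-id

      onBalls-outside : ∀ q {b} k → b < N → k ≤ b → (λ u → ⟦ onBalls q k ⟧ (δ*-ball b u)) ∼ (λ u → 0#)
      onBalls-outside q zero    b<N k≤b = ∼-reflexive λ u → refl
      onBalls-outside q (suc k) b<N k<b = ∼-trans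
        (∼-+ (onBalls-outside q k b<N (ℕProp.<⇒≤ k<b))
             (onBall-distinct (q k) b<N (ℕProp.<-trans k<b b<N) (ℕProp.>⇒≢ k<b)))
        (∼-reflexive λ u → +-identityˡ 0#)

      onBalls-inside : ∀ q {b} k → b < k → k ≤ N → (λ u → ⟦ onBalls q k ⟧ (δ*-ball b u)) ∼ ⟦ q b ⟧₁
      onBalls-inside q {b} (suc k) (s≤s b≤k) k<N with ℕProp.m≤n⇒m<n∨m≡n b≤k
      ... | inj₁ b<k = ∼-trans
        (∼-+ (onBalls-inside q k b<k (ℕProp.<⇒≤ k<N))
             (onBall-distinct (q k) (ℕProp.<-trans b<k k<N) k<N (ℕProp.<⇒≢ b<k)))
        (∼-reflexive λ u → +-identityʳ _)
      ... | inj₂ ≡.refl = ∼-trans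
        (∼-+ (onBalls-outside q k k<N ℕProp.≤-refl)
             (onBall-inside m (fromℤ (+ k)) (q k) (∼-reflexive λ u → refl)))
        (∼-reflexive λ u → +-identityˡ _)

      -- A single polynomial in the iterates of δ serves all balls at once. The error is π times a
      -- family `h` of the same kind as `q`, which is what allows the process to be iterated.
      interpolate : (q : ℕ → Expr 1) → Σ[ h ∈ (ℕ → Expr 1) ]
        (∀ b → b < N → ∀ u → ⟦ q b ⟧₁ u ≈ ⟦ onBalls q N ⟧ (δ*-ball b u) + π * ⟦ h b ⟧₁ u)
      interpolate q = h , h-eq
        where
        h : ℕ → Expr 1
        -- The remainder of `onBalls-inside` changes sides, hence the sign; for `b ≥ N` a dummy
        -- value keeps `h` total.
        h b with b ℕProp.<? N
        ... | yes b<N = con (- 1#) ⊗ rest (onBalls-inside q N b<N ℕProp.≤-refl)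
        ... | no  _   = con 0#
        h-eq : ∀ b → b < N → ∀ u → ⟦ q b ⟧₁ u ≈ ⟦ onBalls q N ⟧ (δ*-ball b u) + π * ⟦ h b ⟧₁ u
        h-eq b b<N u with b ℕProp.<? N
        ... | no  b≮N  = contradiction b<N b≮N
        ... | yes b<N′ = begin
          ⟦ q b ⟧₁ u
            ≈⟨ solve 3 (λ q π r → q := (q :+ π :* r) :+ π :* :- r) refl (⟦ q b ⟧₁ u) π r ⟩
          (⟦ q b ⟧₁ u + π * r) + π * - r
            ≈⟨ +-cong (rest-eq q∼ u) (*-congˡ (-1*x≈-x r)) ⟨
          ⟦ onBalls q N ⟧ (δ*-ball b u) + π * (- 1# * r) ∎
          where
          q∼ = onBalls-inside q N b<N′ ℕProp.≤-refl
          r  = ⟦ rest q∼ ⟧₁ u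

      module _ (T : ℕ → ℕ → Expr 1) where

        -- The error on ball `b` after `n` rounds, divided by `π ^ n`. Each round interpolates it
        -- together with the new terms `T n`.
        remainder : ℕ → ℕ → Expr 1
        remainder zero    b = con 0#
        remainder (suc n) b = proj₁ (interpolate λ c → T n c ⊕ remainder n c) b

        coefficient : ℕ → Expr (suc m)
        coefficient n = onBalls (λ c → T n c ⊕ remainder n c) N

        expansion : ∀ n b → b < N → ∀ u →
          πSum (λ j → ⟦ T j b ⟧₁ u) n ≈
          πSum (λ j → ⟦ coefficient j ⟧ (δ*-ball b u)) n + π ^ n * ⟦ remainder n b ⟧₁ u
        expansion zero    b b<N u = sym (trans (+-congˡ (zeroʳ _)) (+-identityʳ _))
        expansion (suc n) b b<N u = begin
          πSum (λ j → ⟦ T j b ⟧₁ u) n + π ^ n * ⟦ T n b ⟧₁ u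
            ≈⟨ +-congʳ (expansion n b b<N u) ⟩
          (s + π ^ n * ⟦ remainder n b ⟧₁ u) + π ^ n * ⟦ T n b ⟧₁ u
            ≈⟨ solve 4 (λ s πⁿ r t → (s :+ πⁿ :* r) :+ πⁿ :* t := s :+ πⁿ :* (t :+ r)) refl _ _ _ _ ⟩
          s + π ^ n * (⟦ T n b ⟧₁ u + ⟦ remainder n b ⟧₁ u)
            ≈⟨ +-congˡ (*-congˡ (proj₂ (interpolate λ c → T n c ⊕ remainder n c) b b<N u)) ⟩
          s + π ^ n * (⟦ coefficient n ⟧ (δ*-ball b u) + π * ⟦ remainder (suc n) b ⟧₁ u)
            ≈⟨ solve 5 (λ s πⁿ c π r → s :+ πⁿ :* (c :+ π :* r) := (s :+ πⁿ :* c) :+ π :* πⁿ :* r) refl _ _ _ _ _ ⟩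
          (s + π ^ n * ⟦ coefficient n ⟧ (δ*-ball b u)) + π ^ suc n * ⟦ remainder (suc n) b ⟧₁ u ∎
          where s = πSum (λ j → ⟦ coefficient j ⟧ (δ*-ball b u)) n

        expansion-at : ∀ n {a} b u → b < N → a ≈ fromℤ (+ b) + π ^ m * u → ∃[ z ]
          πSum (λ j → ⟦ T j b ⟧₁ u) n ≈
          πSum (λ j → ⟦ coefficient j ⟧ (Vec.iterate δ a (suc m))) n + π ^ n * z
        expansion-at n b u b<N a≈ = _ , trans (expansion n b b<N u)
          (+-congʳ (πSum-cong n λ j → ⟦⟧-cong (coefficient j) (δ*-cong (suc m) (sym a≈))))

    -- A restricted series as a sum of polynomials times powers of π.

    module Slices (F : ℕ → Carrier) (N : ℕ → ℕ) (high : ∀ n i → N n ≤ i → ∃[ z ] F i ≈ π ^ n * z) where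

      -- Adding up the bounds makes the cuts increase even if `N` does not. From degree `cut n` on,
      -- coefficients are divisible by `π ^ n`: trivially for `n = 0`, otherwise because `cut n` is
      -- at least `N n`.
      cut : ℕ → ℕ
      cut zero    = 0
      cut (suc n) = cut n ℕ.+ N (suc n)

      quotient : ∀ n i → ∃[ z ] F (cut n ℕ.+ i) ≈ π ^ n * z
      quotient zero    i = F i , sym (*-identityˡ (F i))
      quotient (suc n) i = high (suc n) _ (ℕProp.≤-trans (ℕProp.m≤n+m _ (cut n)) (ℕProp.m≤m+n _ i))

      sumTo-quotient : ∀ n l u → sumTo l (λ i → F (cut n ℕ.+ i) * u ^ (cut n ℕ.+ i)) ≈
        π ^ n * sumTo l (λ i → proj₁ (quotient n i) * u ^ (cut n ℕ.+ i))
      sumTo-quotient n l u = trans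
        (sumTo-cong l λ i _ → trans (*-congʳ (proj₂ (quotient n i))) (*-assoc _ _ _))
        (sumTo-*ˡ l (π ^ n) _)

      sumExpr : ℕ → (ℕ → Expr 1) → Expr 1
      sumExpr zero    e = con 0#
      sumExpr (suc l) e = e 0 ⊕ sumExpr l (e ∘ suc)

      ⟦sumExpr⟧ : ∀ (l : ℕ) (e : ℕ → Expr 1) u → ⟦ sumExpr l e ⟧₁ u ≈ sumTo l (λ i → ⟦ e i ⟧₁ u)
      ⟦sumExpr⟧ zero    e u = refl
      ⟦sumExpr⟧ (suc l) e u = +-congˡ (⟦sumExpr⟧ l (e ∘ suc) u)

      sliceTerm : ℕ → ℕ → Expr 1
      sliceTerm n i = con (proj₁ (quotient n i)) ⊗ var Fin.zero ⊛ (cut n ℕ.+ i)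

      slice : ℕ → Expr 1
      slice n = sumExpr (N (suc n)) (sliceTerm n)

      πSum-slice : ∀ n u → πSum (λ j → ⟦ slice j ⟧₁ u) n ≈ sumTo (cut n) (λ i → F i * u ^ i)
      πSum-slice zero    u = refl
      πSum-slice (suc n) u = sym (begin
        sumTo (cut n ℕ.+ N (suc n)) (λ i → F i * u ^ i)
          ≈⟨ sumTo-split (cut n) (N (suc n)) _ ⟩
        sumTo (cut n) (λ i → F i * u ^ i) + sumTo (N (suc n)) (λ i → F (cut n ℕ.+ i) * u ^ (cut n ℕ.+ i))
          ≈⟨ +-cong (sym (πSum-slice n u)) (sumTo-quotient n (N (suc n)) u) ⟩
        πSum (λ j → ⟦ slice j ⟧₁ u) n + π ^ n * sumTo (N (suc n)) (λ i → proj₁ (quotient n i) * u ^ (cut n ℕ.+ i))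
          ≈⟨ +-congˡ (*-congˡ (trans
               (sumTo-cong (N (suc n)) λ i _ → *-congˡ (sym (⟦⊛⟧ (var Fin.zero) (cut n ℕ.+ i) (u ∷ []))))
               (sym (⟦sumExpr⟧ (N (suc n)) (sliceTerm n) u)))) ⟩
        πSum (λ j → ⟦ slice j ⟧₁ u) n + π ^ n * ⟦ slice n ⟧₁ u ∎)

      partialSum-slice : ∀ n u l → ∃[ z ]
        sumTo (cut n ℕ.+ l) (λ i → F i * u ^ i) ≈ πSum (λ j → ⟦ slice j ⟧₁ u) n + π ^ n * z
      partialSum-slice n u l = _ , trans (sumTo-split (cut n) l _) (+-cong (sym (πSum-slice n u)) (sumTo-quotient n l u))

    -- The coefficients of the sum of `π ^ n` times `P n`.

    module Assemble {k : ℕ} (P : ℕ → Expr k) where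

      coeffSum : ℕ → Vec ℕ k → Carrier
      coeffSum n α = πSum (λ j → coeff (terms (P j)) α) n

      maxDegree : ℕ → ℕ
      maxDegree zero    = 0
      maxDegree (suc n) = maxDegree n ℕ.⊔ degBound (terms (P n))

      -- Modulo `π ^ n` the limit series is this polynomial, so `maxDegree n` serves as the bound
      -- both for restrictedness and for the convergence of values.
      coeffSum-high : ∀ n α → maxDegree n ≤ Vec.sum α → coeffSum n α ≈ 0#
      coeffSum-high zero    α _   = refl
      coeffSum-high (suc n) α ≤α = trans
        (+-cong (coeffSum-high n α (ℕProp.m⊔n≤o⇒m≤o (maxDegree n) (degBound (terms (P n))) ≤α))
                (trans (*-congˡ (coeff-high (terms (P n)) α (ℕProp.m⊔n≤o⇒n≤o (maxDegree n) (degBound (terms (P n))) ≤α))) (zeroʳ _)))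
        (+-identityˡ 0#)

      partialSum-coeffSum : ∀ n x M → maxDegree n ≤ M → partialSum (coeffSum n) x M ≈ πSum (λ j → ⟦ P j ⟧ x) n
      partialSum-coeffSum zero    x M _  = partialSum-0 x M
      partialSum-coeffSum (suc n) x M ≤M = trans (partialSum-+ (coeffSum n) _ x M)
        (+-cong (partialSum-coeffSum n x M (ℕProp.m⊔n≤o⇒m≤o (maxDegree n) (degBound (terms (P n))) ≤M))
          (trans (partialSum-*ˡ (π ^ n) (coeff (terms (P n))) x M) (*-congˡ (trans
            (partialSum-coeff (terms (P n)) x M (ℕProp.m⊔n≤o⇒n≤o (maxDegree n) (degBound (terms (P n))) ≤M))
            (evalTerms-terms (P n) x)))))

    -- Congruence modulo powers of π, and convergence.

    infix 4 _≡_[π^_]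

    -- The explicit cofactor expresses the congruence in any ring; `≡p⇒≡π` and `≡π⇒≡p` match it with
    -- congruence of representatives.
    _≡_[π^_] : Carrier → Carrier → ℕ → Set
    x ≡ y [π^ n ] = ∃[ z ] x ≈ y + π ^ n * z

    ≡π-reflexive : ∀ n {x y} → x ≈ y → x ≡ y [π^ n ]
    ≡π-reflexive n x≈y = 0# , trans x≈y (sym (trans (+-congˡ (zeroʳ _)) (+-identityʳ _)))

    ≡π-sym : ∀ n {x y} → x ≡ y [π^ n ] → y ≡ x [π^ n ]
    ≡π-sym n {x} {y} (z , x≈) = - z , (begin
      y                              ≈⟨ solve 3 (λ y πⁿ z → y := (y :+ πⁿ :* z) :+ πⁿ :* :- z) refl y (π ^ n) z ⟩
      (y + π ^ n * z) + π ^ n * - z  ≈⟨ +-congʳ x≈ ⟨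
      x + π ^ n * - z                ∎)

    ≡π-trans : ∀ n {x y z} → x ≡ y [π^ n ] → y ≡ z [π^ n ] → x ≡ z [π^ n ]
    ≡π-trans n {x} {y} {z} (r , x≈) (s , y≈) = s + r , (begin
      x                              ≈⟨ x≈ ⟩
      y + π ^ n * r                  ≈⟨ +-congʳ y≈ ⟩
      (z + π ^ n * s) + π ^ n * r    ≈⟨ solve 4 (λ z πⁿ s r → (z :+ πⁿ :* s) :+ πⁿ :* r := z :+ πⁿ :* (s :+ r)) refl _ _ _ _ ⟩
      z + π ^ n * (s + r)            ∎)

    partialSum-≡π : ∀ n {k} {F G : Vec ℕ k → Carrier} → (∀ α → F α ≡ G α [π^ n ]) →
      ∀ x M → partialSum F x M ≡ partialSum G x M [π^ n ]
    partialSum-≡π n {F = F} {G} F≡G x M = partialSum (proj₁ ∘ F≡G) x M , (begin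
      partialSum F x M
        ≈⟨ partialSum-cong (proj₂ ∘ F≡G) x M ⟩
      partialSum (λ α → G α + π ^ n * proj₁ (F≡G α)) x M
        ≈⟨ partialSum-+ G _ x M ⟩
      partialSum G x M + partialSum (λ α → π ^ n * proj₁ (F≡G α)) x M
        ≈⟨ +-congˡ (partialSum-*ˡ (π ^ n) (proj₁ ∘ F≡G) x M) ⟩
      partialSum G x M + π ^ n * partialSum (proj₁ ∘ F≡G) x M ∎)

    Restricted : ∀ {k} → (Vec ℕ k → Carrier) → Set
    Restricted F = ∀ n → ∃[ N ] (∀ α → N ≤ Vec.sum α → F α ≡ 0# [π^ n ])

    -- A record rather than a synonym, so that conversion checking compares F, x and y
    -- instead of unfolding partial sums.

    record HasValue {k} (F : Vec ℕ k → Carrier) (x : Vec Carrier k) (y : Carrier) : Set where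
      constructor mkValue
      field converges : ∀ n → ∃[ N ] (∀ M → N ≤ M → partialSum F x M ≡ y [π^ n ])

    open HasValue public

    -- From an analytic function to a series in the iterates of δ.

    module Main
      (limit : (s : ℕ → Carrier) → (∀ n → s (suc n) ≡ s n [π^ n ]) → ∃[ x ] ∀ n → x ≡ s n [π^ n ])
      (residue : ∀ m a → ∃[ b ] b < p ℕ.^ m × a ≡ fromℤ (+ b) [π^ m ])
      (residue-unique : ∀ m {b c} → b < p ℕ.^ m → c < p ℕ.^ m → fromℤ (+ b) ≡ fromℤ (+ c) [π^ m ] → b ≡ c)
      (f : Carrier → Carrier) (f-cong : ∀ {a b} → a ≈ b → f a ≈ f b) (m : ℕ)
      (f-analytic : ∀ a → Σ[ F ∈ (Vec ℕ 1 → Carrier) ]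
        Restricted F × (∀ u → HasValue F (u ∷ []) (f (a + π ^ m * u))))
      where

      private module Ball (b : ℕ) where

        F = proj₁ (f-analytic (fromℤ (+ b)))
        F-restricted = proj₁ (proj₂ (f-analytic (fromℤ (+ b))))
        F-value = proj₂ (proj₂ (f-analytic (fromℤ (+ b))))

        high : ∀ n i → proj₁ (F-restricted n) ≤ i → ∃[ z ] F (i ∷ []) ≈ π ^ n * z
        high n i N≤i =
          map₂ (λ F≈ → trans F≈ (+-identityˡ _))
            (proj₂ (F-restricted n) (i ∷ []) (ℕProp.≤-trans N≤i (ℕProp.m≤m+n i 0)))

        open Slices (λ i → F (i ∷ [])) (proj₁ ∘ F-restricted) high public using (slice)
        open Slices (λ i → F (i ∷ [])) (proj₁ ∘ F-restricted) high using (cut; partialSum-slice)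

        value : ∀ n u → f (fromℤ (+ b) + π ^ m * u) ≡ πSum (λ j → ⟦ slice j ⟧₁ u) n [π^ n ]
        value n u = ≡π-trans n
          -- The length `cut n + l` lies beyond both the convergence threshold `l` and the cut, so
          -- this partial sum can be compared with either side.
          (≡π-sym n (proj₂ (converges (F-value u) n) (cut n ℕ.+ l) (ℕProp.m≤n+m l (cut n))))
          (≡π-trans n (≡π-reflexive n (partialSum₁ F u (cut n ℕ.+ l))) (partialSum-slice n u l))
          where l = proj₁ (converges (F-value u) n)

      P : ℕ → Expr (suc m)
      P = coefficient m (p ℕ.^ m) (residue-unique m) (λ n b → Ball.slice b n)

      open Assemble P

      series-limit : ∀ α → ∃[ x ] ∀ n → x ≡ coeffSum n α [π^ n ]
      -- Consecutive sums differ by `π ^ n` times a coefficient by definition of `πSum`, hence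
      -- `refl`.
      series-limit α = limit (λ n → coeffSum n α) (λ n → _ , refl)

      series : Vec ℕ (suc m) → Carrier
      series = proj₁ ∘ series-limit

      series-restricted : Restricted series
      series-restricted n = maxDegree n , λ α ≤α →
        ≡π-trans n (proj₂ (series-limit α) n) (≡π-reflexive n (coeffSum-high n α ≤α))

      -- Both sides are compared modulo `π ^ n` with the first `n` terms of the expansion: the
      -- series through `coeffSum n`, and `f a` through the slices on the ball of the residue `b` of
      -- `a`.
      series-value : ∀ a → HasValue series (Vec.iterate δ a (suc m)) (f a)
      series-value a = mkValue λ n → maxDegree n , λ M ≤M →
        ≡π-trans n (partialSum-≡π n (λ α → proj₂ (series-limit α) n) x M)
          (≡π-trans n (≡π-reflexive n (partialSum-coeffSum n x M ≤M))
            (≡π-sym n (≡π-trans n (≡π-reflexive n (f-cong a≈))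
              (≡π-trans n (Ball.value b n u)
                (expansion-at m (p ℕ.^ m) (residue-unique m) (λ n b → Ball.slice b n) n b u b< a≈)))))
        where
        x  = Vec.iterate δ a (suc m)
        b  = proj₁ (residue m a)
        b< = proj₁ (proj₂ (residue m a))
        u  = proj₁ (proj₂ (proj₂ (residue m a)))
        a≈ = proj₂ (proj₂ (proj₂ (residue m a)))

      δ-expansion : Σ[ G ∈ (Vec ℕ (suc m) → Carrier) ]
        Restricted G × (∀ a → HasValue G (Vec.iterate δ a (suc m)) (f a))
      δ-expansion = series , series-restricted , series-value

-- The required properties of the p-adic integers.

module PadicDeltaRing (p : ℕ) (p-prime : Prime p) where

  open Padic p p-prime

  private
    π : ℤ-p
    π = fromℤ (+ p)

    instance
      p-nonZero : ℕ.NonZero p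
      p-nonZero = prime⇒nonZero p-prime

  p^-nonZero : ∀ n → ℕ.NonZero (p ℕ.^ n)
  p^-nonZero n = ℕProp.m^n≢0 p n

  +^≡p^ : ∀ n → (+ p) ℤ.^ n ≡ p^ n
  +^≡p^ zero    = ≡.refl
  +^≡p^ (suc n) = ≡.trans (≡.cong (+ p ℤ.*_) (+^≡p^ n)) (≡.sym (p^-suc n))

  rep-π^ : ∀ n k → rep (π ^ n) k ≡ p^ n
  rep-π^ n k = ≡.trans (rep-^ π n k) (+^≡p^ n)

  p^-+ : ∀ m n → p^ (m ℕ.+ n) ≡ p^ m ℤ.* p^ n
  p^-+ m n = ≡.trans (≡.cong +_ (ℕProp.^-distribˡ-+-* p m n)) (ℤProp.pos-* (p ℕ.^ m) (p ℕ.^ n))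

  mod-lower : ∀ m n {x y} → x ≡ y [mod p^ (m ℕ.+ n) ] → x ≡ y [mod p^ m ]
  mod-lower m n {x} {y} (mk d) = mk (ℤ∣.∣-trans (divides (p^ n) (≡.trans (p^-+ m n) (ℤProp.*-comm (p^ m) (p^ n)))) d)

  mod-p^-cancel : ∀ m n {x y} → x ℤ.* p^ m ≡ y ℤ.* p^ m [mod p^ (m ℕ.+ n) ] → x ≡ y [mod p^ n ]
  mod-p^-cancel m n {x} {y} (mk d) = mk (ℤ∣.*-cancelʳ-∣ (p^ m) ⦃ p^-nonZero m ⦄
    (≡.subst₂ _∣ℤ_ (≡.trans (p^-+ m n) (ℤProp.*-comm (p^ m) (p^ n))) (distrib x y (p^ m)) d))
    where
    distrib : ∀ a b c → a ℤ.* c ℤ.- b ℤ.* c ≡ (a ℤ.- b) ℤ.* c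
    distrib = solve-∀

  rep-coherent : ∀ x n k → rep x (n ℕ.+ k) ≡ rep x n [mod p^ n ]
  rep-coherent x n zero    = mod-reflexive (≡.cong (rep x) (ℕProp.+-identityʳ n))
  rep-coherent x n (suc k) = mod-trans
    (mod-trans (mod-reflexive (≡.cong (rep x) (ℕProp.+-suc n k)))
               (mod-lower n k (coherent x (n ℕ.+ k))))
    (rep-coherent x n k)

  -- Cancelling p costs one level of precision, so level `n` is obtained from the hypothesis at
  -- level `suc n`.
  *-cancelˡ-p : ∀ x y → π * x ≈ π * y → x ≈ y
  *-cancelˡ-p x y πx≈πy n = mod-trans (mod-sym (coherent x n)) (mod-trans
    (mod-p^-cancel 1 n (mod-trans (mod-reflexive (swap (rep x (suc n))))
      (mod-trans (πx≈πy (suc n)) (mod-reflexive (≡.sym (swap (rep y (suc n))))))))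
    (coherent y n))
    where
    swap : ∀ z → z ℤ.* p^ 1 ≡ + p ℤ.* z
    swap z = ≡.trans (≡.cong (λ w → z ℤ.* + w) (ℕProp.^-identityʳ p)) (ℤProp.*-comm z (+ p))

  -- Level `k` of the cofactor is the exact quotient by `p ^ n` of the difference at level `n + k`;
  -- the shift compensates for the precision lost in the division.
  ≡p⇒≡π : ∀ n {x y} → x ≡ y [p^ n ] → ∃[ z ] x ≈ y + π ^ n * z
  ≡p⇒≡π n {x} {y} x≡y = z , eq
    where
    divisible : ∀ k → p^ n ∣ℤ (rep x (n ℕ.+ k) ℤ.- rep y (n ℕ.+ k))
    divisible k = diff (mod-trans (rep-coherent x n k) (mod-trans x≡y (mod-sym (rep-coherent y n k))))
    q : ℕ → ℤ
    q k = _∣ℤ_.quotient (divisible k)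
    q-eq : ∀ k → rep x (n ℕ.+ k) ℤ.- rep y (n ℕ.+ k) ≡ q k ℤ.* p^ n
    q-eq k = _∣ℤ_.equality (divisible k)
    step : ∀ w k → rep w (n ℕ.+ suc k) ≡ rep w (n ℕ.+ k) [mod p^ (n ℕ.+ k) ]
    step w k = mod-trans (mod-reflexive (≡.cong (rep w) (ℕProp.+-suc n k))) (coherent w (n ℕ.+ k))
    q-coherent : ∀ k → q (suc k) ≡ q k [mod p^ k ]
    q-coherent k = mod-p^-cancel n k (mod-trans (mod-reflexive (≡.sym (q-eq (suc k))))
      (mod-trans (mod-+ (step x k) (mod-neg (step y k))) (mod-reflexive (q-eq k))))
    z : ℤ-p
    z = mkℤ-p q q-coherent
    lower : ∀ w k → rep w (n ℕ.+ k) ≡ rep w k [mod p^ k ]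
    lower w k = mod-trans (mod-reflexive (≡.cong (rep w) (ℕProp.+-comm n k))) (rep-coherent w k n)
    split : ∀ a b → a ≡ b ℤ.+ (a ℤ.- b)
    split = solve-∀
    eq : x ≈ y + π ^ n * z
    eq k = mod-trans (mod-sym (lower x k)) (mod-trans
      (mod-reflexive (≡.trans (split (rep x (n ℕ.+ k)) (rep y (n ℕ.+ k)))
        (≡.cong (λ w → rep y (n ℕ.+ k) ℤ.+ w) (≡.trans (q-eq k) (≡.trans (ℤProp.*-comm (q k) (p^ n))
          (≡.cong (ℤ._* q k) (≡.sym (rep-π^ n k))))))))
      (mod-+ (lower y k) (mod-reflexive ≡.refl)))

  ≡π⇒≡p : ∀ n {x y} → ∃[ z ] x ≈ y + π ^ n * z → x ≡ y [p^ n ]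
  ≡π⇒≡p n {x} {y} (z , x≈) = mod-trans (x≈ n) (mk (divides (rep z n)
    (≡.trans (cancel (rep y n) (rep (π ^ n) n) (rep z n)) (≡.cong (rep z n ℤ.*_) (rep-π^ n n)))))
    where
    cancel : ∀ y c z → y ℤ.+ c ℤ.* z ℤ.- y ≡ z ℤ.* c
    cancel = solve-∀

  p∣⇒ : ∀ x → x ≡ 0# [p^ 1 ] → ∃[ y ] x ≈ π * y
  p∣⇒ x x≡0 = let y , x≈ = ≡p⇒≡π 1 {x} {0#} x≡0 in y , λ n → mod-trans (x≈ n)
    (mod-reflexive (simplify (+ p) (rep y n)))
    where
    simplify : ∀ c y → 0ℤ ℤ.+ c ℤ.* 1ℤ ℤ.* y ≡ c ℤ.* y
    simplify = solve-∀

  -- By `fermat`, p divides `z - z^p`, which is `z` times the claimed multiple; Euclid's lemma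
  -- removes the factor `z`.
  fermat-little : ∀ z → ¬ (+ p ∣ℤ z) → + p ∣ℤ (1ℤ ℤ.- z ℤ.^ pred p)
  fermat-little z p∤z with euclidsLemma ℤ.∣ z ∣ ℤ.∣ 1ℤ ℤ.- z ℤ.^ pred p ∣ p-prime
    (≡.subst (p ℕ∣.∣_) (ℤProp.abs-* z (1ℤ ℤ.- z ℤ.^ pred p)) (ℤ∣.∣⇒∣ᵤ factored))
    where
    expand : ∀ z w → z ℤ.- z ℤ.* w ≡ z ℤ.* (1ℤ ℤ.- w)
    expand = solve-∀
    factored : + p ∣ℤ (z ℤ.* (1ℤ ℤ.- z ℤ.^ pred p))
    factored = ≡.subst (+ p ∣ℤ_)
      (≡.trans (≡.cong (λ k → z ℤ.- z ℤ.^ k) (≡.sym (ℕProp.suc-pred p))) (expand z (z ℤ.^ pred p)))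
      (diff (fermat p-prime z))
  ... | inj₁ p∣z = contradiction (ℤ∣.∣ᵤ⇒∣ p∣z) p∤z
  ... | inj₂ p∣1-z = ℤ∣.∣ᵤ⇒∣ p∣1-z

  ∣⇒≡0 : ∀ {z} → + p ∣ℤ z → z ≡ 0ℤ [mod p^ 1 ]
  ∣⇒≡0 {z} p∣z = ∣⇒mod-0 (≡.subst (λ w → + w ∣ℤ z) (≡.sym (ℕProp.^-identityʳ p)) p∣z)

  p∣⊎p∣1-^ : ∀ x → (∃[ y ] x ≈ π * y) ⊎ (∃[ y ] 1# - x ^ pred p ≈ π * y)
  p∣⊎p∣1-^ x with (+ p) ℤ∣.∣? rep x 1
  ... | yes p∣x = inj₁ (p∣⇒ x (∣⇒≡0 p∣x))
  ... | no  p∤x = inj₂ (p∣⇒ (1# - x ^ pred p) (∣⇒≡0 (≡.subst (λ w → + p ∣ℤ (1ℤ ℤ.- w)) (≡.sym (rep-^ x (pred p) 1)) (fermat-little (rep x 1) p∤x))))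

  -- The diagonal: level `n` of the limit is read off from `s n`, so the required congruences are
  -- reflexive.
  limit : (s : ℕ → ℤ-p) → (∀ n → s (suc n) ≡ s n [p^ n ]) → ∃[ x ] ∀ n → x ≡ s n [p^ n ]
  limit s s-cauchy =
    mkℤ-p (λ n → rep (s n) n) (λ n → mod-trans (coherent (s (suc n)) n) (s-cauchy n)) ,
    λ n → mod-reflexive ≡.refl

  residue : ∀ m a → ∃[ b ] b < p ℕ.^ m × a ≡ fromℤ (+ b) [p^ m ]
  residue m a = rep a m ℤ/.%ℕ (p ℕ.^ m) , ℤ/.n%ℕd<d (rep a m) (p ℕ.^ m) ,
    mk (divides (rep a m ℤ/./ℕ (p ℕ.^ m)) (≡.trans
      (≡.cong (λ w → w ℤ.- + (rep a m ℤ/.%ℕ (p ℕ.^ m))) (ℤ/.a≡a%ℕn+[a/ℕn]*n (rep a m) (p ℕ.^ m)))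
      (cancel (+ (rep a m ℤ/.%ℕ (p ℕ.^ m))) _)))
    where
    instance _ = p^-nonZero m
    cancel : ∀ r w → r ℤ.+ w ℤ.- r ≡ w
    cancel = solve-∀

  residue-unique : ∀ m {b c} → b < p ℕ.^ m → c < p ℕ.^ m → fromℤ (+ b) ≡ fromℤ (+ c) [p^ m ] → b ≡ c
  residue-unique m {b} {c} b< c< (mk d) =
    ℤProp.+-injective (ℤProp.i-j≡0⇒i≡j (+ b) (+ c) (ℤProp.∣i∣≡0⇒i≡0 (small ∣b-c∣< (ℤ∣.∣⇒∣ᵤ d))))
    where
    small : ∀ {k n} → k < n → n ℕ∣.∣ k → k ≡ 0
    small {zero}  _   _   = ≡.refl
    small {suc k} k<n n∣k = contradiction n∣k (ℕ∣.>⇒∤ k<n)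
    ∣b-c∣< : ℤ.∣ + b ℤ.- + c ∣ < p ℕ.^ m
    ∣b-c∣< = ℕProp.≤-<-trans
      (≡.subst (ℕ._≤ b ℕ.⊔ c) (≡.cong ℤ.∣_∣ (≡.sym (ℤProp.[+m]-[+n]≡m⊖n b c))) (ℤProp.∣m⊝n∣≤m⊔n b c))
      (ℕProp.⊔-lub b< c<)

  -- Transfer between the abstract and the p-adic notions.

  -- The operations on ℤ-p are named in full below: the names brought in by opening Padic p p-prime
  -- are synonyms, and comparing a synonym with its unfolding compares the coherence proofs.

  private
    module R = CommutativeRing (Padic.commutativeRing p p-prime)
    module Sums = FiniteSums (Padic.commutativeRing p p-prime)
    module Abstract = DeltaRing (Padic.commutativeRing p p-prime) (Padic.fromℤ p p-prime)
      (λ _ _ _ → mod-reflexive ≡.refl) (λ _ _ _ → mod-reflexive ≡.refl) (λ _ _ → mod-reflexive ≡.refl)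
      (λ _ → mod-reflexive ≡.refl) (λ _ → mod-reflexive ≡.refl)
      p p-prime *-cancelˡ-p (Padic.δ p p-prime) (λ a b → δ-cong {a} {b}) δ-spec p∣⊎p∣1-^
    module Poly = Polynomials (Padic.commutativeRing p p-prime) p p-prime

  -- The abstract and the p-adic version are separate recursive functions with the same clauses, so
  -- they are identified by induction.
  monomial≡ : ∀ {k} (x : Vec ℤ-p k) α → Poly.monomial x α ≡ monomial x α
  monomial≡ []       []      = ≡.refl
  monomial≡ (x ∷ xs) (i ∷ α) = ≡.cong (x ^ i *_) (monomial≡ xs α)

  sumOver≡ : ∀ {A : Set} (as : List A) (s t : A → ℤ-p) → (∀ a → s a ≡ t a) → Sums.sumOver as s ≡ sumOver as t
  sumOver≡ List.[]       s t s≡t = ≡.refl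
  sumOver≡ (a List.∷ as) s t s≡t = ≡.cong₂ R._+_ (s≡t a) (sumOver≡ as s t s≡t)

  partialSum≡ : ∀ {k} (F : PowerSeries k) x N → Poly.partialSum F x N ≡ partialSum F x N
  partialSum≡ {k} F x N = sumOver≡ (List.upTo N)
    (λ d → Sums.sumOver (exponents k d) λ α → F α R.* Poly.monomial x α)
    (λ d → sumOver (exponents k d) λ α → F α * monomial x α)
    λ d → sumOver≡ (exponents k d) (λ α → F α R.* Poly.monomial x α) (λ α → F α * monomial x α)
      λ α → ≡.cong (F α R.*_) (monomial≡ x α)

  restricted⇒ : ∀ {k} {F : PowerSeries k} → Restricted F → Abstract.Restricted F
  restricted⇒ {F = F} h n = map₂ (λ h α ≤α → ≡p⇒≡π n {F α} {0#} (h α ≤α)) (h n)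

  restricted⇐ : ∀ {k} {F : PowerSeries k} → Abstract.Restricted F → Restricted F
  restricted⇐ {F = F} h n = map₂ (λ h α ≤α → ≡π⇒≡p n {F α} {0#} (h α ≤α)) (h n)

  hasValue⇒ : ∀ {k} {F : PowerSeries k} {x y} → F ⟨ x ⟩≈ y → Abstract.HasValue F x y
  hasValue⇒ {F = F} {x} {y} h = Abstract.mkValue λ n → map₂ (λ h M ≤M →
    ≡p⇒≡π n {Poly.partialSum F x M} {y} (≡.subst (_≡ y [p^ n ]) (≡.sym (partialSum≡ F x M)) (h M ≤M))) (h n)

  hasValue⇐ : ∀ {k} {F : PowerSeries k} {x y} → Abstract.HasValue F x y → F ⟨ x ⟩≈ y
  hasValue⇐ {F = F} {x} {y} h n = map₂ (λ h M ≤M →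
    ≡.subst (_≡ y [p^ n ]) (partialSum≡ F x M) (≡π⇒≡p n {Poly.partialSum F x M} {y} (h M ≤M))) (Abstract.converges h n)

  limit-π : (s : ℕ → ℤ-p) → (∀ n → s (suc n) Abstract.≡ s n [π^ n ]) → ∃[ x ] ∀ n → x Abstract.≡ s n [π^ n ]
  limit-π s s-cauchy = map₂ (λ {x} h n → ≡p⇒≡π n {x} {s n} (h n))
    (limit s λ n → ≡π⇒≡p n {s (suc n)} {s n} (s-cauchy n))

  residue-π : ∀ m a → ∃[ b ] b < p ℕ.^ m × a Abstract.≡ fromℤ (+ b) [π^ m ]
  residue-π m a = let b , b< , a≡b = residue m a in b , b< , ≡p⇒≡π m {a} {fromℤ (+ b)} a≡b

  residue-unique-π : ∀ m {b c} → b < p ℕ.^ m → c < p ℕ.^ m → fromℤ (+ b) Abstract.≡ fromℤ (+ c) [π^ m ] → b ≡ c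
  residue-unique-π m {b} {c} b< c< b≡c =
    residue-unique m b< c< (≡π⇒≡p m {fromℤ (+ b)} {fromℤ (+ c)} b≡c)

  analytic⇒arithmeticDifferential : ∀ m f → IsAnalyticOfLevel m f → IsArithmeticDifferentialOperatorOfOrder m f
  analytic⇒arithmeticDifferential m f f-analytic = arithmetic⇐
    (Abstract.Main.δ-expansion limit-π residue-π residue-unique-π to (λ {a} {b} → cong {a} {b}) m analytic⇒)
    where
    open Func f using (to; cong)

    ball : ℤ-p → ℤ-p → ℤ-p
    ball a u = Padic._+_ p p-prime a (Padic._*_ p p-prime (Padic._^_ p p-prime (Padic.fromℤ p p-prime (+ p)) m) u)

    analytic⇒ : ∀ a → Σ[ F ∈ PowerSeries 1 ]
      Abstract.Restricted F × (∀ u → Abstract.HasValue F (u ∷ []) (to (ball a u)))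
    analytic⇒ a = let F , F-restricted , F-value = f-analytic a in
      F , restricted⇒ {F = F} F-restricted , λ u → hasValue⇒ {F = F} {u ∷ []} {to (ball a u)} (F-value u)

    arithmetic⇐ : (Σ[ G ∈ PowerSeries (suc m) ]
      Abstract.Restricted G × (∀ a → Abstract.HasValue G (Vec.iterate (Padic.δ p p-prime) a (suc m)) (to a))) →
      IsArithmeticDifferentialOperatorOfOrder m f
    arithmetic⇐ (G , G-restricted , G-value) = G , restricted⇐ {F = G} G-restricted ,
      λ a → hasValue⇐ {F = G} {Vec.iterate (Padic.δ p p-prime) a (suc m)} {to a} (G-value a)

theorem1p5 : (p : ℕ) (p-prime : Prime p) (m : ℕ) →
    let open Padic p p-prime in
    (f : Func setoid setoid) →
    IsAnalyticOfLevel m f →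
    IsArithmeticDifferentialOperatorOfOrder m f
theorem1p5 p p-prime = PadicDeltaRing.analytic⇒arithmeticDifferential p p-prime
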